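{- For all real numbers $s \in (0,1)$ and $p \in (0,1/2]$, the random XOR-formula $Q^{p}(n, sn)$ is with high probability $\Omega(n)$-separated; that is, there exists a function $g(n) \in \Omega(n)$ such that $\lim_{n\to\infty} \Pr[Q^{p}(n, sn) \text{ is } g(n)\text{ -separated}] = 1$.
   Context: Let $X_1, \dots, X_n$ be propositional variables. An XOR-clause over $n$ variables is the exclusive-or of exactly one of the constants $0$ or $1$ together with a subset of the variables $X_1,\dots,X_n$; if it includes the constant $0$ (respectively $1$), it evaluates to true under a truth assignment if and only if an odd (respectively even) number of its included variables evaluate to true. A random XOR-clause with variable-probability $p \in [0,1]$ is obtained by including each $X_i$ independently with probability $p$, and (independently) including the constant $1$ with probability $1/2$ and the constant $0$ otherwise. For a positive integer $n$, a nonnegative real $s$, and $p\in[0,1]$, $Q^{p}(n, sn)$ denotes the random formula that is the conjunction of $\lceil sn \rceil$ independently chosen random XOR-clauses over $n$ variables with variable-probability $p$. A solution of a formula is a truth assignment to $X_1,\dots,X_n$ under which the formula evaluates to true. For a real number $d$, a formula is $d$-separated if the Hamming distance between every pair of distinct solutions is at least $d$ (vacuously true if there are fewer than two solutions). $g(n)\in\Omega(n)$ means there is a constant $c>0$ with $g(n)\ge cn$ for all sufficiently large $n$. A sequence of events $E_n$ occurs with high probability if $\Pr[E_n]\to 1$ as $n\to\infty$. -}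

module Defs where

open import Data.Bool.Base using (Bool; true; false; _∧_; _xor_; if_then_else_)
import Data.Bool.Properties as Bool
open import Data.Fin.Subset using (Subset)
open import Data.Integer.Base using (+_)
open import Data.List.Base using (List; []; _∷_; map; concatMap; foldr)
open import Data.Nat.Base as ℕ using (ℕ; zero; suc)
import Data.Nat.Properties as ℕ
open import Data.Product.Base using (Σ-syntax; ∃-syntax; _×_; _,_; map₂; uncurry)
open import Data.Rational.Base as ℚ using (ℚ; 0ℚ; 1ℚ; ½)
import Data.Rational.Properties as ℚ
open import Data.Vec.Base as Vec using (Vec; []; _∷_)
open import Data.Vec.Relation.Unary.All using (All)
open import Function.Base using (_∘_)
open import Level using (0ℓ)
open import Relation.Binary.PropositionalEquality
  using (_≡_; _≢_; sym; trans; cong; cong₂; subst)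
open import Relation.Nullary.Decidable using (Dec; does; ¬?; dec⇒maybe)
open import Tactic.RingSolver using (solve-∀)
open import Tactic.RingSolver.Core.AlmostCommutativeRing
  using (AlmostCommutativeRing; fromCommutativeRing)

-- Real numbers, as Cauchy sequences of rationals.  Two sequences x and y
-- denote the same number when x ≤ℝ y and y ≤ℝ x; all the notions below
-- respect this.

Cauchy : (ℕ → ℚ) → Set
Cauchy x = ∀ (ε : ℚ) → 0ℚ ℚ.< ε →
  ∃[ N ] (∀ m n → N ℕ.≤ m → N ℕ.≤ n → ℚ.∣ x m ℚ.- x n ∣ ℚ.< ε)

record ℝ : Set where
  constructor mkℝ
  field
    seq    : ℕ → ℚ
    cauchy : Cauchy seq

open ℝ public

infix 4 _<ℝ_ _≤ℝ_ _⟶_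

_<ℝ_ : ℝ → ℝ → Set
x <ℝ y = ∃[ ε ] (0ℚ ℚ.< ε × ∃[ N ] (∀ n → N ℕ.≤ n → seq x n ℚ.+ ε ℚ.≤ seq y n))

_≤ℝ_ : ℝ → ℝ → Set
x ≤ℝ y = ∀ (ε : ℚ) → 0ℚ ℚ.< ε → ∃[ N ] (∀ n → N ℕ.≤ n → seq x n ℚ.≤ seq y n ℚ.+ ε)

private
  ℚ-ring : AlmostCommutativeRing 0ℓ 0ℓ
  ℚ-ring = fromCommutativeRing ℚ.+-*-commutativeRing (λ q → dec⇒maybe (0ℚ ℚ.≟ q))

  abstract
    neg-sub : ∀ a b → ℚ.- (a ℚ.- b) ≡ (ℚ.- a) ℚ.- (ℚ.- b)
    neg-sub = solve-∀ ℚ-ring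

    +-sub : ∀ a b c d → (a ℚ.+ b) ℚ.- (c ℚ.+ d) ≡ (a ℚ.- c) ℚ.+ (b ℚ.- d)
    +-sub = solve-∀ ℚ-ring

    add-sub : ∀ a b → a ≡ b ℚ.+ (a ℚ.- b)
    add-sub = solve-∀ ℚ-ring

    *-sub : ∀ a b c d → a ℚ.* b ℚ.- c ℚ.* d ≡ a ℚ.* (b ℚ.- d) ℚ.+ d ℚ.* (a ℚ.- c)
    *-sub = solve-∀ ℚ-ring

    0<½* : ∀ {ε} → 0ℚ ℚ.< ε → 0ℚ ℚ.< ½ ℚ.* ε
    0<½* {ε} 0<ε = subst (ℚ._< ½ ℚ.* ε) (ℚ.*-zeroʳ ½) (ℚ.*-monoʳ-<-pos ½ 0<ε)

    halves : ∀ ε → ½ ℚ.* ε ℚ.+ ½ ℚ.* ε ≡ ε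
    halves ε = trans (sym (ℚ.*-distribʳ-+ ε ½ ½)) (ℚ.*-identityˡ ε)

    const-cauchy : ∀ q → Cauchy (λ _ → q)
    const-cauchy q ε 0<ε =
      0 , λ _ _ _ _ → subst (λ z → ℚ.∣ z ∣ ℚ.< ε) (sym (ℚ.+-inverseʳ q)) 0<ε

    neg-cauchy : ∀ x → Cauchy x → Cauchy (λ n → ℚ.- x n)
    neg-cauchy x cx ε 0<ε with cx ε 0<ε
    ... | N , h = N , λ m n N≤m N≤n →
      subst (ℚ._< ε) (trans (sym (ℚ.∣-p∣≡∣p∣ _)) (cong ℚ.∣_∣ (neg-sub (x m) (x n)))) (h m n N≤m N≤n)

    +-cauchy : ∀ x y → Cauchy x → Cauchy y → Cauchy (λ n → x n ℚ.+ y n)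
    +-cauchy x y cx cy ε 0<ε
      with cx (½ ℚ.* ε) (0<½* 0<ε) | cy (½ ℚ.* ε) (0<½* 0<ε)
    ... | N₁ , h₁ | N₂ , h₂ = N₁ ℕ.⊔ N₂ , λ m n N≤m N≤n → begin-strict
      ℚ.∣ (x m ℚ.+ y m) ℚ.- (x n ℚ.+ y n) ∣
        ≡⟨ cong ℚ.∣_∣ (+-sub (x m) (y m) (x n) (y n)) ⟩
      ℚ.∣ (x m ℚ.- x n) ℚ.+ (y m ℚ.- y n) ∣
        ≤⟨ ℚ.∣p+q∣≤∣p∣+∣q∣ (x m ℚ.- x n) (y m ℚ.- y n) ⟩
      ℚ.∣ x m ℚ.- x n ∣ ℚ.+ ℚ.∣ y m ℚ.- y n ∣
        <⟨ ℚ.+-mono-< (h₁ m n (ℕ.m⊔n≤o⇒m≤o N₁ N₂ N≤m) (ℕ.m⊔n≤o⇒m≤o N₁ N₂ N≤n))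
                      (h₂ m n (ℕ.m⊔n≤o⇒n≤o N₁ N₂ N≤m) (ℕ.m⊔n≤o⇒n≤o N₁ N₂ N≤n)) ⟩
      ½ ℚ.* ε ℚ.+ ½ ℚ.* ε
        ≡⟨ halves ε ⟩
      ε ∎
      where open ℚ.≤-Reasoning

    eventually-bounded : ∀ x → Cauchy x →
      ∃[ B ] (ℚ.Positive B × ∃[ N ] (∀ n → N ℕ.≤ n → ℚ.∣ x n ∣ ℚ.≤ B))
    eventually-bounded x cx with cx 1ℚ (ℚ.positive⁻¹ 1ℚ)
    ... | N , h = ℚ.∣ x N ∣ ℚ.+ 1ℚ
                , ℚ.nonNeg+pos⇒pos ℚ.∣ x N ∣ {{ℚ.∣-∣-nonNeg (x N)}} 1ℚ
                , N , λ n N≤n → begin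
      ℚ.∣ x n ∣                            ≡⟨ cong ℚ.∣_∣ (add-sub (x n) (x N)) ⟩
      ℚ.∣ x N ℚ.+ (x n ℚ.- x N) ∣          ≤⟨ ℚ.∣p+q∣≤∣p∣+∣q∣ (x N) (x n ℚ.- x N) ⟩
      ℚ.∣ x N ∣ ℚ.+ ℚ.∣ x n ℚ.- x N ∣      ≤⟨ ℚ.+-monoʳ-≤ ℚ.∣ x N ∣ (ℚ.<⇒≤ (h n N N≤n ℕ.≤-refl)) ⟩
      ℚ.∣ x N ∣ ℚ.+ 1ℚ                     ∎
      where open ℚ.≤-Reasoning

    rescale : ∀ B → ℚ.Positive B → ∀ η → 0ℚ ℚ.< η → ∃[ δ ] (0ℚ ℚ.< δ × B ℚ.* δ ≡ η)
    rescale B B>0 η 0<η = B⁻¹ ℚ.* η , 0<δ , Bδ≡η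
      where
      B≢0 : ℚ.NonZero B
      B≢0 = ℚ.pos⇒nonZero B {{B>0}}
      B⁻¹ : ℚ
      B⁻¹ = ℚ.1/_ B {{B≢0}}
      0<δ : 0ℚ ℚ.< B⁻¹ ℚ.* η
      0<δ = subst (ℚ._< B⁻¹ ℚ.* η) (ℚ.*-zeroʳ B⁻¹)
              (ℚ.*-monoʳ-<-pos B⁻¹ {{ℚ.1/pos⇒pos B {{B>0}}}} 0<η)
      Bδ≡η : B ℚ.* (B⁻¹ ℚ.* η) ≡ η
      Bδ≡η = trans (sym (ℚ.*-assoc B B⁻¹ η))
               (trans (cong (ℚ._* η) (ℚ.*-inverseʳ B {{B≢0}})) (ℚ.*-identityˡ η))

    ∣*∣-bound : ∀ {B} → ℚ.Positive B → ∀ a d {δ} →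
                ℚ.∣ a ∣ ℚ.≤ B → ℚ.∣ d ∣ ℚ.< δ → ℚ.∣ a ℚ.* d ∣ ℚ.< B ℚ.* δ
    ∣*∣-bound {B} B>0 a d {δ} a≤B d<δ = begin-strict
      ℚ.∣ a ℚ.* d ∣          ≡⟨ ℚ.∣p*q∣≡∣p∣*∣q∣ a d ⟩
      ℚ.∣ a ∣ ℚ.* ℚ.∣ d ∣    ≤⟨ ℚ.*-monoʳ-≤-nonNeg ℚ.∣ d ∣ {{ℚ.∣-∣-nonNeg d}} a≤B ⟩
      B ℚ.* ℚ.∣ d ∣          <⟨ ℚ.*-monoʳ-<-pos B {{B>0}} d<δ ⟩
      B ℚ.* δ                ∎
      where open ℚ.≤-Reasoning

    *-close : ∀ a b c d {A B α β ε} → ℚ.Positive A → ℚ.Positive B →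
              ℚ.∣ a ∣ ℚ.≤ A → ℚ.∣ d ∣ ℚ.≤ B → ℚ.∣ b ℚ.- d ∣ ℚ.< α → ℚ.∣ a ℚ.- c ∣ ℚ.< β →
              A ℚ.* α ≡ ½ ℚ.* ε → B ℚ.* β ≡ ½ ℚ.* ε →
              ℚ.∣ a ℚ.* b ℚ.- c ℚ.* d ∣ ℚ.< ε
    *-close a b c d {A} {B} {α} {β} {ε} A>0 B>0 a≤A d≤B b-d<α a-c<β Aα≡½ε Bβ≡½ε = begin-strict
      ℚ.∣ a ℚ.* b ℚ.- c ℚ.* d ∣
        ≡⟨ cong ℚ.∣_∣ (*-sub a b c d) ⟩
      ℚ.∣ a ℚ.* (b ℚ.- d) ℚ.+ d ℚ.* (a ℚ.- c) ∣
        ≤⟨ ℚ.∣p+q∣≤∣p∣+∣q∣ (a ℚ.* (b ℚ.- d)) (d ℚ.* (a ℚ.- c)) ⟩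
      ℚ.∣ a ℚ.* (b ℚ.- d) ∣ ℚ.+ ℚ.∣ d ℚ.* (a ℚ.- c) ∣
        <⟨ ℚ.+-mono-< (∣*∣-bound A>0 a (b ℚ.- d) a≤A b-d<α)
                      (∣*∣-bound B>0 d (a ℚ.- c) d≤B a-c<β) ⟩
      A ℚ.* α ℚ.+ B ℚ.* β
        ≡⟨ cong₂ ℚ._+_ Aα≡½ε Bβ≡½ε ⟩
      ½ ℚ.* ε ℚ.+ ½ ℚ.* ε
        ≡⟨ halves ε ⟩
      ε ∎
      where open ℚ.≤-Reasoning

    -- let rather than with, which would normalise the calls to rescale
    *-cauchy : ∀ x y → Cauchy x → Cauchy y → Cauchy (λ n → x n ℚ.* y n)
    *-cauchy x y cx cy ε 0<ε =
      let (A , A>0 , N₁ , x≤A)  = eventually-bounded x cx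
          (B , B>0 , N₂ , y≤B)  = eventually-bounded y cy
          (α , 0<α , Aα≡½ε)     = rescale A A>0 (½ ℚ.* ε) (0<½* 0<ε)
          (β , 0<β , Bβ≡½ε)     = rescale B B>0 (½ ℚ.* ε) (0<½* 0<ε)
          (N₃ , y-close)        = cy α 0<α
          (N₄ , x-close)        = cx β 0<β
      in (N₁ ℕ.⊔ N₂) ℕ.⊔ (N₃ ℕ.⊔ N₄) , λ m n N≤m N≤n →
        let (N₁≤m , _ , N₃≤m , N₄≤m) = split N₁ N₂ N₃ N₄ N≤m
            (_ , N₂≤n , N₃≤n , N₄≤n) = split N₁ N₂ N₃ N₄ N≤n
        in *-close (x m) (y m) (x n) (y n) A>0 B>0
             (x≤A m N₁≤m) (y≤B n N₂≤n) (y-close m n N₃≤m N₃≤n) (x-close m n N₄≤m N₄≤n)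
             Aα≡½ε Bβ≡½ε
      where
      split : ∀ a b c d {k} → (a ℕ.⊔ b) ℕ.⊔ (c ℕ.⊔ d) ℕ.≤ k →
              a ℕ.≤ k × b ℕ.≤ k × c ℕ.≤ k × d ℕ.≤ k
      split a b c d h =
        let h₁ = ℕ.m⊔n≤o⇒m≤o (a ℕ.⊔ b) (c ℕ.⊔ d) h
            h₂ = ℕ.m⊔n≤o⇒n≤o (a ℕ.⊔ b) (c ℕ.⊔ d) h
        in ℕ.m⊔n≤o⇒m≤o a b h₁ , ℕ.m⊔n≤o⇒n≤o a b h₁ , ℕ.m⊔n≤o⇒m≤o c d h₂ , ℕ.m⊔n≤o⇒n≤o c d h₂

infixl 6 _+ℝ_ _-ℝ_
infixl 7 _*ℝ_

fromℚ : ℚ → ℝ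
fromℚ q = mkℝ (λ _ → q) (const-cauchy q)

fromℕ : ℕ → ℝ
fromℕ n = fromℚ (+ n ℚ./ 1)

0ℝ 1ℝ ½ℝ : ℝ
0ℝ = fromℚ 0ℚ
1ℝ = fromℚ 1ℚ
½ℝ = fromℚ ½

_+ℝ_ _-ℝ_ _*ℝ_ : ℝ → ℝ → ℝ
x +ℝ y = mkℝ (λ n → seq x n ℚ.+ seq y n) (+-cauchy (seq x) (seq y) (cauchy x) (cauchy y))
x -ℝ y = mkℝ (λ n → seq x n ℚ.- seq y n)
  (+-cauchy (seq x) (λ n → ℚ.- seq y n) (cauchy x) (neg-cauchy (seq y) (cauchy y)))
x *ℝ y = mkℝ (λ n → seq x n ℚ.* seq y n) (*-cauchy (seq x) (seq y) (cauchy x) (cauchy y))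

-- k = ⌈ x ⌉, for nonnegative x.  This is a relation because the ceiling of
-- a real number cannot be computed.
IsCeiling : ℝ → ℕ → Set
IsCeiling x k = x ≤ℝ fromℕ k × fromℕ k <ℝ x +ℝ 1ℝ

_⟶_ : (ℕ → ℝ) → ℝ → Set
a ⟶ ℓ = ∀ (ε : ℝ) → 0ℝ <ℝ ε →
  ∃[ N ] (∀ n → N ℕ.≤ n → ℓ -ℝ ε <ℝ a n × a n <ℝ ℓ +ℝ ε)

IsΩ[n] : (ℕ → ℝ) → Set
IsΩ[n] g = ∃[ c ] (0ℝ <ℝ c × ∃[ N ] (∀ n → N ℕ.≤ n → c *ℝ fromℕ n ≤ℝ g n))

-- Finitely supported distributions: outcomes listed with their weights,
-- possibly with repetition.

Dist : Set → Set
Dist A = List (A × ℝ)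

pure : ∀ {A} → A → Dist A
pure a = (a , 1ℝ) ∷ []

_>>=_ : ∀ {A B} → Dist A → (A → Dist B) → Dist B
d >>= f = concatMap (λ (a , w) → map (map₂ (w *ℝ_)) (f a)) d

bernoulli : ℝ → Dist Bool
bernoulli p = (true , p) ∷ (false , 1ℝ -ℝ p) ∷ []

iid : ∀ {A} (m : ℕ) → Dist A → Dist (Vec A m)
iid zero    d = pure []
iid (suc m) d = do
  a  ← d
  as ← iid m d
  pure (a ∷ as)

Pr : ∀ {A} → Dist A → {E : A → Set} → (∀ a → Dec (E a)) → ℝ
Pr d E? = foldr (λ (a , w) t → if does (E? a) then w +ℝ t else t) 0ℝ d

-- The decision procedure is only there for Pr to be defined: classically
-- it always exists, and Pr does not depend on which one is chosen.
WithHighProbability : {A : ℕ → Set} → (∀ n → Dist (A n)) → (∀ n → A n → Set) → Set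
WithHighProbability d E =
  Σ[ E? ∈ (∀ n a → Dec (E n a)) ] (λ n → Pr (d n) (E? n)) ⟶ 1ℝ

Assignment : ℕ → Set
Assignment n = Vec Bool n

record Clause (n : ℕ) : Set where
  constructor clause
  field
    constant : Bool
    vars     : Subset n

open Clause public

parity : ∀ {n} → Vec Bool n → Bool
parity = Vec.foldr _ _xor_ false

eval : ∀ {n} → Clause n → Assignment n → Bool
eval C σ = constant C xor parity (Vec.zipWith _∧_ (vars C) σ)

Formula : ℕ → ℕ → Set
Formula n m = Vec (Clause n) m

IsSolution : ∀ {n m} → Formula n m → Assignment n → Set
IsSolution φ σ = All (λ C → eval C σ ≡ true) φ

hamming : ∀ {n} → Assignment n → Assignment n → ℕ
hamming σ τ = Vec.count (¬? ∘ uncurry Bool._≟_) (Vec.zip σ τ)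

Separated : ∀ {n m} → ℝ → Formula n m → Set
Separated d φ = ∀ σ τ → IsSolution φ σ → IsSolution φ τ → σ ≢ τ →
  d ≤ℝ fromℕ (hamming σ τ)

randomClause : ℝ → (n : ℕ) → Dist (Clause n)
randomClause p n = do
  S ← iid n (bernoulli p)
  c ← bernoulli ½ℝ
  pure (clause c S)

-- The second size argument is the number of clauses itself, to be
-- instantiated with ⌈ s n ⌉.
Q : ℝ → (n m : ℕ) → Dist (Formula n m)
Q p n m = iid m (randomClause p n)

-- Evaluate everything in ℚ, at a late coordinate of the Cauchy sequences, where
-- ε ≤ p ≤ 1 − ε.  The sum (mod 2) x of two distinct solutions is a nonzero vector
-- orthogonal to all clauses; fixing all entries of a clause but one in the
-- support of x shows that a random clause is orthogonal to x with probability at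
-- most θ = 1 − ε, so m clauses are with probability at most θ ^ m.  A union bound
-- over the vectors x of weight at most n / L, each counted with weight
-- q ^ (L ∣x∣ − n) ≥ 1 for a suitable q < 1, gives
--   Pr [not separated] ≤ q ^ (- n) (1 + q ^ L) ^ n θ ^ m,
-- which tends to 0 as m ≥ s n once q is close to 1 and L is large.

module Submission where

open import Algebra.Bundles using (CommutativeRing)
open import Data.Bool.Base using (Bool; true; false; _∧_; _∨_; _xor_; not; if_then_else_)
import Algebra.Properties.CommutativeSemigroup as CommutativeSemigroupProperties
import Data.Bool.Properties as Bool
open import Data.Fin.Subset using (∣_∣)
open import Data.Fin.Subset.Properties using (anySubset?)
open import Data.Integer.Base as ℤ using (+_)
import Data.Integer.Properties as ℤ
open import Data.List.Base using ([]; _∷_; _++_; map)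
open import Data.Nat using (ℕ)
open import Data.Nat.Base as ℕ using (zero; suc)
import Data.Nat.Coprimality as Coprimality
import Data.Nat.Properties as ℕ
open import Data.Product using (Σ-syntax; ∃-syntax; _×_; _,_; proj₁; proj₂; map₂)
import Data.Nat.Tactic.RingSolver as ℕ-Solver
open import Data.Sum.Base using (inj₁; inj₂)
open import Data.Rational.Base as ℚ using (ℚ; 0ℚ; 1ℚ; ½; _+_; _*_; _-_; _≤_; _<_)
import Data.Rational.Properties as ℚ
open import Data.Vec.Base as Vec using (Vec; []; _∷_)
open import Data.Vec.Properties using (≡-dec)
open import Data.Vec.Relation.Unary.All as All using ([]; _∷_)
open import Function.Base using (_∘_)
open import Relation.Binary.PropositionalEquality
  using (_≡_; _≢_; refl; sym; trans; cong; cong₂; subst; subst₂; module ≡-Reasoning)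
open import Relation.Nullary using (Dec; yes; no; ¬_; contradiction)
open import Relation.Nullary.Decidable using (dec⇒maybe; does; map′; decidable-stable; ¬?; _→-dec_)
open import Tactic.RingSolver using (solve-∀)
open import Tactic.RingSolver.Core.AlmostCommutativeRing
  using (AlmostCommutativeRing; fromCommutativeRing)
open import Level using (0ℓ)
open import Algebra.Properties.CommutativeSemiring.Exp
  (CommutativeRing.commutativeSemiring ℚ.+-*-commutativeRing)
  using (_^_; ^-homo-*; ^-assocʳ; ^-distrib-*)
open import Defs

private
  ℚ-ring : AlmostCommutativeRing 0ℓ 0ℓ
  ℚ-ring = fromCommutativeRing ℚ.+-*-commutativeRing (λ q → dec⇒maybe (0ℚ ℚ.≟ q))

-- Order and powers in ℚ.

≤⇒0≤- : ∀ {a b} → a ≤ b → 0ℚ ≤ b - a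
≤⇒0≤- {a} {b} a≤b = subst (_≤ b - a) (ℚ.+-inverseʳ a) (ℚ.+-monoˡ-≤ (ℚ.- a) a≤b)

0≤-⇒≤ : ∀ {a b} → 0ℚ ≤ b - a → a ≤ b
0≤-⇒≤ {a} {b} h = subst₂ _≤_ (ℚ.+-identityˡ a) (cancel a b) (ℚ.+-monoˡ-≤ a h)
  where
  cancel : ∀ a b → b - a + a ≡ b
  cancel = solve-∀ ℚ-ring

0≤+ : ∀ {a b} → 0ℚ ≤ a → 0ℚ ≤ b → 0ℚ ≤ a + b
0≤+ 0≤a 0≤b = ℚ.+-mono-≤ 0≤a 0≤b

*-monoˡ-≤ : ∀ {a b} c → 0ℚ ≤ c → a ≤ b → c * a ≤ c * b
*-monoˡ-≤ c 0≤c = ℚ.*-monoˡ-≤-nonNeg c {{ℚ.nonNegative 0≤c}}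

*-monoʳ-≤ : ∀ {a b} c → 0ℚ ≤ c → a ≤ b → a * c ≤ b * c
*-monoʳ-≤ c 0≤c = ℚ.*-monoʳ-≤-nonNeg c {{ℚ.nonNegative 0≤c}}

0≤* : ∀ {a b} → 0ℚ ≤ a → 0ℚ ≤ b → 0ℚ ≤ a * b
0≤* {a} {b} 0≤a 0≤b = subst (_≤ a * b) (ℚ.*-zeroʳ a) (*-monoˡ-≤ a 0≤a 0≤b)

0<* : ∀ {a b} → 0ℚ < a → 0ℚ < b → 0ℚ < a * b
0<* {a} {b} 0<a 0<b = subst (_< a * b) (ℚ.*-zeroʳ a)
  (ℚ.*-monoʳ-<-pos a {{ℚ.positive 0<a}} 0<b)

*-mono-≤ : ∀ {a b c d} → 0ℚ ≤ b → 0ℚ ≤ c → a ≤ b → c ≤ d → a * c ≤ b * d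
*-mono-≤ {b = b} {c = c} 0≤b 0≤c a≤b c≤d =
  ℚ.≤-trans (*-monoʳ-≤ c 0≤c a≤b) (*-monoˡ-≤ b 0≤b c≤d)

0≤1 : 0ℚ ≤ 1ℚ
0≤1 = ℚ.nonNegative⁻¹ 1ℚ

^-nonNeg : ∀ {q} → 0ℚ ≤ q → ∀ n → 0ℚ ≤ q ^ n
^-nonNeg 0≤q zero    = 0≤1
^-nonNeg 0≤q (suc n) = 0≤* 0≤q (^-nonNeg 0≤q n)

^-pos : ∀ {q} → 0ℚ < q → ∀ n → 0ℚ < q ^ n
^-pos 0<q zero    = ℚ.positive⁻¹ 1ℚ
^-pos 0<q (suc n) = 0<* 0<q (^-pos 0<q n)

^-monoˡ-≤ : ∀ {a b} → 0ℚ ≤ a → a ≤ b → ∀ n → a ^ n ≤ b ^ n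
^-monoˡ-≤ 0≤a a≤b zero    = ℚ.≤-refl
^-monoˡ-≤ 0≤a a≤b (suc n) =
  *-mono-≤ (ℚ.≤-trans 0≤a a≤b) (^-nonNeg 0≤a n) a≤b (^-monoˡ-≤ 0≤a a≤b n)

1^n≡1 : ∀ n → 1ℚ ^ n ≡ 1ℚ
1^n≡1 zero    = refl
1^n≡1 (suc n) = trans (ℚ.*-identityˡ _) (1^n≡1 n)

^-≤1 : ∀ {q} → 0ℚ ≤ q → q ≤ 1ℚ → ∀ n → q ^ n ≤ 1ℚ
^-≤1 {q} 0≤q q≤1 n = subst (q ^ n ≤_) (1^n≡1 n) (^-monoˡ-≤ 0≤q q≤1 n)

^-antitoneʳ : ∀ {q} → 0ℚ ≤ q → q ≤ 1ℚ → ∀ {m n} → m ℕ.≤ n → q ^ n ≤ q ^ m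
^-antitoneʳ 0≤q q≤1 {n = n} ℕ.z≤n = ^-≤1 0≤q q≤1 n
^-antitoneʳ {q} 0≤q q≤1 (ℕ.s≤s m≤n) = *-monoˡ-≤ q 0≤q (^-antitoneʳ 0≤q q≤1 m≤n)

-- The embedding of ℕ into ℚ and the Archimedean property.

ι : ℕ → ℚ
ι n = + n ℚ./ 1

abstract
  ι-suc : ∀ n → ι (suc n) ≡ 1ℚ + ι n
  -- For a variable `n` the fraction `+ n ℚ./ 1` is stuck on a gcd; the rewrite replaces it by a
  -- reduced literal, on which addition computes.
  ι-suc n rewrite ℚ.normalize-coprime {n} {0} (Coprimality.sym (Coprimality.1-coprimeTo n)) =
    cong (λ k → (ℤ.1ℤ ℤ.+ k) ℚ./ 1) (sym (ℤ.*-identityʳ (+ n)))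

0≤ι : ∀ n → 0ℚ ≤ ι n
0≤ι zero    = ℚ.≤-refl
0≤ι (suc n) = subst (0ℚ ≤_) (sym (ι-suc n)) (0≤+ 0≤1 (0≤ι n))

ι-mono-≤ : ∀ {m n} → m ℕ.≤ n → ι m ≤ ι n
ι-mono-≤ {n = n} ℕ.z≤n       = 0≤ι n
ι-mono-≤ (ℕ.s≤s {m} {n} m≤n) =
  subst₂ _≤_ (sym (ι-suc m)) (sym (ι-suc n)) (ℚ.+-monoʳ-≤ 1ℚ (ι-mono-≤ m≤n))

ι-+ : ∀ m n → ι (m ℕ.+ n) ≡ ι m + ι n
ι-+ zero    n = sym (ℚ.+-identityˡ (ι n))
ι-+ (suc m) n = begin
  ι (suc (m ℕ.+ n))    ≡⟨ ι-suc (m ℕ.+ n) ⟩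
  1ℚ + ι (m ℕ.+ n)     ≡⟨ cong (λ z → 1ℚ + z) (ι-+ m n) ⟩
  1ℚ + (ι m + ι n)     ≡⟨ ℚ.+-assoc 1ℚ (ι m) (ι n) ⟨
  1ℚ + ι m + ι n       ≡⟨ cong (_+ ι n) (ι-suc m) ⟨
  ι (suc m) + ι n      ∎
  where open ≡-Reasoning

ι-* : ∀ m n → ι (m ℕ.* n) ≡ ι m * ι n
ι-* zero    n = sym (ℚ.*-zeroˡ (ι n))
ι-* (suc m) n = begin
  ι (n ℕ.+ m ℕ.* n)    ≡⟨ ι-+ n (m ℕ.* n) ⟩
  ι n + ι (m ℕ.* n)    ≡⟨ cong (λ z → ι n + z) (ι-* m n) ⟩
  ι n + ι m * ι n      ≡⟨ factor (ι m) (ι n) ⟩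
  (1ℚ + ι m) * ι n     ≡⟨ cong (_* ι n) (ι-suc m) ⟨
  ι (suc m) * ι n      ∎
  where
  open ≡-Reasoning
  factor : ∀ a b → b + a * b ≡ (1ℚ + a) * b
  factor = solve-∀ ℚ-ring

ι-cancel-≤ : ∀ {m n} → ι m ≤ ι n → m ℕ.≤ n
ι-cancel-≤ {m} {n} ιm≤ιn with m ℕ.≤? n
... | yes m≤n = m≤n
... | no  m≰n = contradiction (begin-strict
  ι m         ≤⟨ ιm≤ιn ⟩
  ι n         ≡⟨ ℚ.+-identityˡ (ι n) ⟨
  0ℚ + ι n    <⟨ ℚ.+-monoˡ-< (ι n) (ℚ.positive⁻¹ 1ℚ) ⟩
  1ℚ + ι n    ≡⟨ ι-suc n ⟨
  ι (suc n)   ≤⟨ ι-mono-≤ (ℕ.≰⇒> m≰n) ⟩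
  ι m         ∎) (ℚ.<-irrefl refl)
  where open ℚ.≤-Reasoning

abstract
  ≤ι : ∀ r → ∃[ n ] r ≤ ι n
  ≤ι (ℚ.mkℚ ℤ.-[1+ a ] d c) = 0 , ℚ.*≤* ℤ.-≤+
  -- The denominator is at least 1, so a nonnegative fraction is at most its numerator.
  ≤ι r@(ℚ.mkℚ (+ a) d c) = a ,
    subst (r ≤_) (sym (ℚ.normalize-coprime (Coprimality.sym (Coprimality.1-coprimeTo a))))
      (ℚ.*≤* (ℤ.*-monoˡ-≤-nonNeg (+ a) (ℤ.+≤+ (ℕ.s≤s ℕ.z≤n))))

abstract
  archimedean : ∀ {ε} → 0ℚ < ε → ∃[ n ] 1ℚ ≤ ι n * ε
  archimedean {ε} 0<ε = n , ℚ.≤-trans (ℚ.≤-reflexive (sym (ℚ.*-inverseˡ ε)))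
                              (*-monoʳ-≤ ε (ℚ.<⇒≤ 0<ε) 1/ε≤n)
    where
    instance
      ε≢0 : ℚ.NonZero ε
      ε≢0 = ℚ.pos⇒nonZero ε {{ℚ.positive 0<ε}}
    n : ℕ
    n = proj₁ (≤ι (ℚ.1/ ε))
    1/ε≤n : ℚ.1/ ε ≤ ι n
    1/ε≤n = proj₂ (≤ι (ℚ.1/ ε))

abstract
  equal-parts : ∀ {ε} → 0ℚ < ε → ∀ n → ∃[ δ ] (0ℚ < δ × ι (suc n) * δ ≡ ε)
  equal-parts {ε} 0<ε n = ℚ.1/ N * ε , 0<* (ℚ.positive⁻¹ (ℚ.1/ N) {{ℚ.1/pos⇒pos N}}) 0<ε ,
      trans (sym (ℚ.*-assoc N (ℚ.1/ N) ε)) (trans (cong (_* ε) (ℚ.*-inverseʳ N)) (ℚ.*-identityˡ ε))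
    where
    N : ℚ
    N = ι (suc n)
    instance
      N>0 : ℚ.Positive N
      N>0 = ℚ.positive (ℚ.<-≤-trans (ℚ.positive⁻¹ 1ℚ) (ι-mono-≤ (ℕ.s≤s (ℕ.z≤n {n}))))
      N≢0 : ℚ.NonZero N
      N≢0 = ℚ.pos⇒nonZero N

-- Bernoulli inequalities and vanishing powers.

bernoulli-≤ : ∀ {δ} → 0ℚ ≤ δ → δ ≤ 1ℚ → ∀ n → 1ℚ - ι n * δ ≤ (1ℚ - δ) ^ n
bernoulli-≤ {δ} 0≤δ δ≤1 zero = ℚ.≤-reflexive (cong (1ℚ -_) (ℚ.*-zeroˡ δ))
bernoulli-≤ {δ} 0≤δ δ≤1 (suc n) = begin
  1ℚ - ι (suc n) * δ
    ≡⟨ cong (λ z → 1ℚ - z * δ) (ι-suc n) ⟩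
  1ℚ - (1ℚ + ι n) * δ
    ≤⟨ 0≤-⇒≤ (subst (0ℚ ≤_) (expand (ι n) δ) (0≤* (0≤ι n) (0≤* 0≤δ 0≤δ))) ⟩
  (1ℚ - δ) * (1ℚ - ι n * δ)
    ≤⟨ *-monoˡ-≤ (1ℚ - δ) (≤⇒0≤- δ≤1) (bernoulli-≤ 0≤δ δ≤1 n) ⟩
  (1ℚ - δ) * (1ℚ - δ) ^ n ∎
  where
  open ℚ.≤-Reasoning
  expand : ∀ k δ → k * (δ * δ) ≡ (1ℚ - δ) * (1ℚ - k * δ) - (1ℚ - (1ℚ + k) * δ)
  expand = solve-∀ ℚ-ring

-- The product does not increase with `n`, since (1 - δ)(1 + (k + 1)δ) = 1 + kδ - (k + 1)δ². This
-- bounds the powers of 1 - δ from above by 1 / (1 + nδ), which is enough to make them vanish.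
geometric-≤ : ∀ {δ} → 0ℚ ≤ δ → δ ≤ 1ℚ → ∀ n → (1ℚ - δ) ^ n * (1ℚ + ι n * δ) ≤ 1ℚ
geometric-≤ {δ} 0≤δ δ≤1 zero = ℚ.≤-reflexive (trans (ℚ.*-identityˡ _) (cong (λ z → 1ℚ + z) (ℚ.*-zeroˡ δ)))
geometric-≤ {δ} 0≤δ δ≤1 (suc n) = begin
  (1ℚ - δ) * (1ℚ - δ) ^ n * (1ℚ + ι (suc n) * δ)
    ≡⟨ cong (λ z → (1ℚ - δ) * (1ℚ - δ) ^ n * (1ℚ + z * δ)) (ι-suc n) ⟩
  (1ℚ - δ) * (1ℚ - δ) ^ n * (1ℚ + (1ℚ + ι n) * δ)
    ≤⟨ 0≤-⇒≤ (subst (0ℚ ≤_) (expand ((1ℚ - δ) ^ n) (ι n) δ)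
         (0≤* (^-nonNeg (≤⇒0≤- δ≤1) n) (0≤* (0≤+ 0≤1 (0≤ι n)) (0≤* 0≤δ 0≤δ)))) ⟩
  (1ℚ - δ) ^ n * (1ℚ + ι n * δ)
    ≤⟨ geometric-≤ 0≤δ δ≤1 n ⟩
  1ℚ ∎
  where
  open ℚ.≤-Reasoning
  expand : ∀ r k δ → r * ((1ℚ + k) * (δ * δ)) ≡
           r * (1ℚ + k * δ) - (1ℚ - δ) * r * (1ℚ + (1ℚ + k) * δ)
  expand = solve-∀ ℚ-ring

abstract
  ^-vanishes : ∀ {δ ε} → 0ℚ < δ → δ ≤ 1ℚ → 0ℚ < ε → ∃[ N ] (∀ n → N ℕ.≤ n → (1ℚ - δ) ^ n ≤ ε)
  ^-vanishes {δ} {ε} 0<δ δ≤1 0<ε = N , λ n N≤n →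
      ℚ.≤-trans (^-antitoneʳ (≤⇒0≤- δ≤1) 1-δ≤1 N≤n) bound
    where
    open ℚ.≤-Reasoning
    N : ℕ
    -- With `1ℚ ≤ ι N * (δ * ε)`, inserting this factor into `r` makes an `ε` appear; what remains
    -- is bounded by `geometric-≤`.
    N = proj₁ (archimedean (0<* 0<δ 0<ε))
    0≤δ : 0ℚ ≤ δ
    0≤δ = ℚ.<⇒≤ 0<δ
    0≤ε : 0ℚ ≤ ε
    0≤ε = ℚ.<⇒≤ 0<ε
    r : ℚ
    r = (1ℚ - δ) ^ N
    1-δ≤1 : 1ℚ - δ ≤ 1ℚ
    1-δ≤1 = ℚ.+-monoʳ-≤ 1ℚ (ℚ.neg-antimono-≤ 0≤δ)
    0≤r : 0ℚ ≤ r
    0≤r = ^-nonNeg (≤⇒0≤- δ≤1) N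
    expand : ∀ r k δ ε → r * ε ≡ r * (1ℚ + k * δ) * ε - r * (k * (δ * ε))
    expand = solve-∀ ℚ-ring
    bound : r ≤ ε
    bound = begin
      r                            ≡⟨ ℚ.*-identityʳ r ⟨
      r * 1ℚ                       ≤⟨ *-monoˡ-≤ r 0≤r (proj₂ (archimedean (0<* 0<δ 0<ε))) ⟩
      r * (ι N * (δ * ε))          ≤⟨ 0≤-⇒≤ (subst (0ℚ ≤_) (expand r (ι N) δ ε) (0≤* 0≤r 0≤ε)) ⟩
      r * (1ℚ + ι N * δ) * ε       ≤⟨ *-monoʳ-≤ ε 0≤ε (geometric-≤ 0≤δ δ≤1 N) ⟩
      1ℚ * ε                       ≡⟨ ℚ.*-identityˡ ε ⟩
      ε                            ∎

-- Expectations at a fixed coordinate of the real weights.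

𝔼 : ∀ {A} → ℕ → Dist A → (A → ℚ) → ℚ
𝔼 j []            f = 0ℚ
𝔼 j ((a , w) ∷ d) f = seq w j * f a + 𝔼 j d f

-- Stands in for nonnegativity of the weights at coordinate `j`, which can fail at early coordinates
-- of a real number. In this form it passes through `>>=` by `𝔼->>=` alone.
record Monotone {A} (j : ℕ) (d : Dist A) : Set where
  constructor monotone
  field
    𝔼-mono : ∀ {f g} → (∀ a → f a ≤ g a) → 𝔼 j d f ≤ 𝔼 j d g

open Monotone

indicator : Bool → ℚ
indicator b = if b then 1ℚ else 0ℚ

0≤indicator : ∀ b → 0ℚ ≤ indicator b
0≤indicator true  = 0≤1
0≤indicator false = ℚ.≤-refl

indicator≤1 : ∀ b → indicator b ≤ 1ℚ
indicator≤1 true  = ℚ.≤-refl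
indicator≤1 false = 0≤1

∏ : ∀ {A : Set} {m} → (A → ℚ) → Vec A m → ℚ
∏ g []       = 1ℚ
∏ g (a ∷ as) = g a * ∏ g as

module _ (j : ℕ) where
  open ≡-Reasoning

  Pr-𝔼 : ∀ {A} (d : Dist A) {E : A → Set} (E? : ∀ a → Dec (E a)) →
         seq (Pr d E?) j ≡ 𝔼 j d (λ a → indicator (does (E? a)))
  Pr-𝔼 []            E? = refl
  Pr-𝔼 ((a , w) ∷ d) E? with does (E? a)
  ... | true  = cong₂ _+_ (sym (ℚ.*-identityʳ (seq w j))) (Pr-𝔼 d E?)
  ... | false = trans (Pr-𝔼 d E?)
    (trans (sym (ℚ.+-identityˡ _)) (cong (_+ 𝔼 j d _) (sym (ℚ.*-zeroʳ (seq w j)))))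

  𝔼-cong : ∀ {A} (d : Dist A) {f g} → (∀ a → f a ≡ g a) → 𝔼 j d f ≡ 𝔼 j d g
  𝔼-cong []            f≡g = refl
  𝔼-cong ((a , w) ∷ d) f≡g = cong₂ (λ y z → seq w j * y + z) (f≡g a) (𝔼-cong d f≡g)

  𝔼-zero : ∀ {A} (d : Dist A) → 𝔼 j d (λ _ → 0ℚ) ≡ 0ℚ
  𝔼-zero []            = refl
  𝔼-zero ((a , w) ∷ d) = trans (cong₂ _+_ (ℚ.*-zeroʳ (seq w j)) (𝔼-zero d)) (ℚ.+-identityˡ 0ℚ)

  𝔼-+ : ∀ {A} (d : Dist A) f g → 𝔼 j d (λ a → f a + g a) ≡ 𝔼 j d f + 𝔼 j d g
  𝔼-+ []            f g = sym (ℚ.+-identityˡ 0ℚ)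
  𝔼-+ ((a , w) ∷ d) f g =
    trans (cong (λ z → seq w j * (f a + g a) + z) (𝔼-+ d f g))
          (regroup (seq w j) (f a) (g a) (𝔼 j d f) (𝔼 j d g))
    where
    regroup : ∀ w a b x y → w * (a + b) + (x + y) ≡ w * a + x + (w * b + y)
    regroup = solve-∀ ℚ-ring

  𝔼-*ˡ : ∀ {A} (d : Dist A) c f → 𝔼 j d (λ a → c * f a) ≡ c * 𝔼 j d f
  𝔼-*ˡ []            c f = sym (ℚ.*-zeroʳ c)
  𝔼-*ˡ ((a , w) ∷ d) c f =
    trans (cong (λ z → seq w j * (c * f a) + z) (𝔼-*ˡ d c f))
          (regroup (seq w j) c (f a) (𝔼 j d f))
    where
    regroup : ∀ w c a x → w * (c * a) + c * x ≡ c * (w * a + x)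
    regroup = solve-∀ ℚ-ring

  𝔼-*ʳ : ∀ {A} (d : Dist A) c f → 𝔼 j d (λ a → f a * c) ≡ 𝔼 j d f * c
  𝔼-*ʳ d c f = trans (𝔼-cong d (λ a → ℚ.*-comm (f a) c))
                     (trans (𝔼-*ˡ d c f) (ℚ.*-comm c (𝔼 j d f)))

  𝔼-const : ∀ {A} (d : Dist A) c → 𝔼 j d (λ _ → 1ℚ) ≡ 1ℚ → 𝔼 j d (λ _ → c) ≡ c
  𝔼-const d c mass≡1 = begin
    𝔼 j d (λ _ → c)         ≡⟨ 𝔼-cong d (λ _ → sym (ℚ.*-identityˡ c)) ⟩
    𝔼 j d (λ _ → 1ℚ * c)    ≡⟨ 𝔼-*ʳ d c (λ _ → 1ℚ) ⟩
    𝔼 j d (λ _ → 1ℚ) * c    ≡⟨ cong (_* c) mass≡1 ⟩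
    1ℚ * c                  ≡⟨ ℚ.*-identityˡ c ⟩
    c                       ∎

  -- Fubini for finite sums. In the union bound it exchanges the random formula with the weighted
  -- sum over vectors.
  𝔼-swap : ∀ {A B} (d : Dist A) (e : Dist B) (f : A → B → ℚ) →
           𝔼 j d (λ a → 𝔼 j e (f a)) ≡ 𝔼 j e (λ b → 𝔼 j d (λ a → f a b))
  𝔼-swap []            e f = sym (𝔼-zero e)
  𝔼-swap ((a , w) ∷ d) e f = begin
    seq w j * 𝔼 j e (f a) + 𝔼 j d (λ a′ → 𝔼 j e (f a′))
      ≡⟨ cong₂ _+_ (sym (𝔼-*ˡ e (seq w j) (f a))) (𝔼-swap d e f) ⟩
    𝔼 j e (λ b → seq w j * f a b) + 𝔼 j e (λ b → 𝔼 j d (λ a′ → f a′ b))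
      ≡⟨ 𝔼-+ e _ _ ⟨
    𝔼 j e (λ b → seq w j * f a b + 𝔼 j d (λ a′ → f a′ b)) ∎

  𝔼-++ : ∀ {A} (d e : Dist A) f → 𝔼 j (d ++ e) f ≡ 𝔼 j d f + 𝔼 j e f
  𝔼-++ []            e f = sym (ℚ.+-identityˡ _)
  𝔼-++ ((a , w) ∷ d) e f =
    trans (cong (λ z → seq w j * f a + z) (𝔼-++ d e f)) (sym (ℚ.+-assoc (seq w j * f a) _ _))

  𝔼-scale : ∀ {A} (d : Dist A) v f → 𝔼 j (map (map₂ (v *ℝ_)) d) f ≡ seq v j * 𝔼 j d f
  𝔼-scale []            v f = sym (ℚ.*-zeroʳ (seq v j))
  𝔼-scale ((a , w) ∷ d) v f =
    trans (cong (λ z → seq v j * seq w j * f a + z) (𝔼-scale d v f))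
          (factor (seq v j) (seq w j) (f a) (𝔼 j d f))
    where
    factor : ∀ v w a x → v * w * a + v * x ≡ v * (w * a + x)
    factor = solve-∀ ℚ-ring

  𝔼->>= : ∀ {A B} (d : Dist A) (k : A → Dist B) f → 𝔼 j (d >>= k) f ≡ 𝔼 j d (λ a → 𝔼 j (k a) f)
  𝔼->>= []            k f = refl
  𝔼->>= ((a , w) ∷ d) k f =
    trans (𝔼-++ (map (map₂ (w *ℝ_)) (k a)) (d >>= k) f)
          (cong₂ _+_ (𝔼-scale (k a) w f) (𝔼->>= d k f))

  𝔼-pure : ∀ {A} (a : A) f → 𝔼 j (pure a) f ≡ f a
  𝔼-pure a f = trans (ℚ.+-identityʳ (1ℚ * f a)) (ℚ.*-identityˡ (f a))

  𝔼-iid-suc : ∀ {A} m (d : Dist A) (f : Vec A (suc m) → ℚ) →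
    𝔼 j (iid (suc m) d) f ≡ 𝔼 j d (λ a → 𝔼 j (iid m d) (λ as → f (a ∷ as)))
  𝔼-iid-suc m d f =
    trans (𝔼->>= d _ f) (𝔼-cong d λ a →
    trans (𝔼->>= (iid m d) (λ as → pure (a ∷ as)) f) (𝔼-cong (iid m d) λ as → 𝔼-pure (a ∷ as) f))

  -- Independence. It yields both the factor `θ ^ m` for the clauses and, with `g` constantly 1, the
  -- total mass of an iid vector.
  𝔼-iid-∏ : ∀ {A} m (d : Dist A) (g : A → ℚ) → 𝔼 j (iid m d) (∏ g) ≡ 𝔼 j d g ^ m
  𝔼-iid-∏ zero    d g = 𝔼-pure [] (∏ g)
  𝔼-iid-∏ (suc m) d g = begin
    𝔼 j (iid (suc m) d) (∏ g)
      ≡⟨ 𝔼-iid-suc m d (∏ g) ⟩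
    𝔼 j d (λ a → 𝔼 j (iid m d) (λ as → g a * ∏ g as))
      ≡⟨ 𝔼-cong d (λ a → 𝔼-*ˡ (iid m d) (g a) (∏ g)) ⟩
    𝔼 j d (λ a → g a * 𝔼 j (iid m d) (∏ g))
      ≡⟨ 𝔼-*ʳ d (𝔼 j (iid m d) (∏ g)) g ⟩
    𝔼 j d g * 𝔼 j (iid m d) (∏ g)
      ≡⟨ cong (λ z → 𝔼 j d g * z) (𝔼-iid-∏ m d g) ⟩
    𝔼 j d g * 𝔼 j d g ^ m ∎

  ∏-1 : ∀ {A : Set} {m} (as : Vec A m) → ∏ (λ _ → 1ℚ) as ≡ 1ℚ
  ∏-1 []       = refl
  ∏-1 (a ∷ as) = trans (ℚ.*-identityˡ _) (∏-1 as)

  𝔼-iid-mass : ∀ {A} m (d : Dist A) → 𝔼 j (iid m d) (λ _ → 1ℚ) ≡ 𝔼 j d (λ _ → 1ℚ) ^ m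
  𝔼-iid-mass m d = trans (𝔼-cong (iid m d) (λ as → sym (∏-1 as))) (𝔼-iid-∏ m d (λ _ → 1ℚ))

  𝔼-iid-mass-1 : ∀ {A} m (d : Dist A) → 𝔼 j d (λ _ → 1ℚ) ≡ 1ℚ → 𝔼 j (iid m d) (λ _ → 1ℚ) ≡ 1ℚ
  𝔼-iid-mass-1 m d mass≡1 = trans (𝔼-iid-mass m d) (trans (cong (_^ m) mass≡1) (1^n≡1 m))

  []-monotone : ∀ {A} → Monotone {A} j []
  []-monotone = monotone λ _ → ℚ.≤-refl

  ∷-monotone : ∀ {A} {a : A} {w d} → 0ℚ ≤ seq w j → Monotone j d → Monotone j ((a , w) ∷ d)
  ∷-monotone {a = a} {w} 0≤w mono = monotone λ f≤g →
    ℚ.+-mono-≤ (*-monoˡ-≤ (seq w j) 0≤w (f≤g a)) (𝔼-mono mono f≤g)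

  >>=-monotone : ∀ {A B} (d : Dist A) (k : A → Dist B) →
                 Monotone j d → (∀ a → Monotone j (k a)) → Monotone j (d >>= k)
  >>=-monotone d k mono mono-k = monotone λ {f} {g} f≤g →
    subst₂ _≤_ (sym (𝔼->>= d k f)) (sym (𝔼->>= d k g)) (𝔼-mono mono (λ a → 𝔼-mono (mono-k a) f≤g))

  pure-monotone : ∀ {A} {a : A} → Monotone j (pure a)
  pure-monotone = ∷-monotone 0≤1 []-monotone

  iid-monotone : ∀ {A} m {d : Dist A} → Monotone j d → Monotone j (iid m d)
  iid-monotone zero        mono = pure-monotone
  iid-monotone (suc m) {d} mono =
    >>=-monotone d _ mono λ a →
    >>=-monotone (iid m d) (λ as → pure (a ∷ as)) (iid-monotone m mono) λ as →
    pure-monotone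

-- Vectors over the two-element field and sums of solutions.

dot : ∀ {n} → Vec Bool n → Vec Bool n → Bool
dot S x = parity (Vec.zipWith _∧_ S x)

nonzero : ∀ {n} → Vec Bool n → Bool
nonzero []      = false
nonzero (b ∷ x) = b ∨ nonzero x

_⊕_ : ∀ {n} → Vec Bool n → Vec Bool n → Vec Bool n
_⊕_ = Vec.zipWith _xor_

dot-⊕ : ∀ {n} (S σ τ : Vec Bool n) → dot S (σ ⊕ τ) ≡ dot S σ xor dot S τ
dot-⊕ []          []      []      = refl
dot-⊕ (true ∷ S)  (a ∷ σ) (b ∷ τ) =
  trans (cong ((a xor b) xor_) (dot-⊕ S σ τ)) (interchange a b (dot S σ) (dot S τ))
  where open CommutativeSemigroupProperties (CommutativeRing.+-commutativeSemigroup Bool.xor-∧-commutativeRing)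
dot-⊕ (false ∷ S) (a ∷ σ) (b ∷ τ) = dot-⊕ S σ τ

hamming-⊕ : ∀ {n} (σ τ : Vec Bool n) → hamming σ τ ≡ ∣ σ ⊕ τ ∣
hamming-⊕ []          []          = refl
hamming-⊕ (true  ∷ σ) (true  ∷ τ) = hamming-⊕ σ τ
hamming-⊕ (true  ∷ σ) (false ∷ τ) = cong suc (hamming-⊕ σ τ)
hamming-⊕ (false ∷ σ) (true  ∷ τ) = cong suc (hamming-⊕ σ τ)
hamming-⊕ (false ∷ σ) (false ∷ τ) = hamming-⊕ σ τ

nonzero-⊕ : ∀ {n} (σ τ : Vec Bool n) → σ ≢ τ → nonzero (σ ⊕ τ) ≡ true
nonzero-⊕ []          []          σ≢τ = contradiction refl σ≢τ
nonzero-⊕ (true  ∷ σ) (true  ∷ τ) σ≢τ = nonzero-⊕ σ τ (σ≢τ ∘ cong (true ∷_))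
nonzero-⊕ (true  ∷ σ) (false ∷ τ) σ≢τ = refl
nonzero-⊕ (false ∷ σ) (true  ∷ τ) σ≢τ = refl
nonzero-⊕ (false ∷ σ) (false ∷ τ) σ≢τ = nonzero-⊕ σ τ (σ≢τ ∘ cong (false ∷_))

-- The constant of the clause cancels in the sum of the two evaluations, leaving the homogeneous
-- equation for `σ ⊕ τ`.
solutions⇒dot-⊕≡false : ∀ {n} (C : Clause n) {σ τ} → eval C σ ≡ true → eval C τ ≡ true →
                        dot (vars C) (σ ⊕ τ) ≡ false
solutions⇒dot-⊕≡false (clause c S) {σ} {τ} evalσ evalτ = begin
  dot S (σ ⊕ τ)          ≡⟨ dot-⊕ S σ τ ⟩
  dot S σ xor dot S τ    ≡⟨ cong (_xor dot S τ) (cancel c (dot S σ) (dot S τ) (trans evalσ (sym evalτ))) ⟩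
  dot S τ xor dot S τ    ≡⟨ Bool.xor-same (dot S τ) ⟩
  false                  ∎
  where
  open ≡-Reasoning
  cancel : ∀ c a b → c xor a ≡ c xor b → a ≡ b
  cancel true  a b = Bool.not-injective
  cancel false a b = λ eq → eq

orthogonal : ∀ {n} → Vec Bool n → Clause n → ℚ
orthogonal x C = indicator (not (dot (vars C) x))

∏-orthogonal-⊕ : ∀ {n m} (φ : Formula n m) {σ τ} → IsSolution φ σ → IsSolution φ τ →
                 ∏ (orthogonal (σ ⊕ τ)) φ ≡ 1ℚ
∏-orthogonal-⊕ []      []            []            = refl
∏-orthogonal-⊕ (C ∷ φ) (evalσ ∷ σ⊨φ) (evalτ ∷ τ⊨φ)
  rewrite solutions⇒dot-⊕≡false C evalσ evalτ =
  trans (ℚ.*-identityˡ _) (∏-orthogonal-⊕ φ σ⊨φ τ⊨φ)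

-- Indicator of `x` being a nonzero vector in the kernel of the coefficient matrix of `φ`, written
-- as a product so that its expectation factorises over the clauses.
kernel : ∀ {n m} → Vec Bool n → Formula n m → ℚ
kernel x φ = indicator (nonzero x) * ∏ (orthogonal x) φ

kernel-⊕ : ∀ {n m} (φ : Formula n m) {σ τ} → IsSolution φ σ → IsSolution φ τ → σ ≢ τ →
           kernel (σ ⊕ τ) φ ≡ 1ℚ
kernel-⊕ φ {σ} {τ} σ⊨φ τ⊨φ σ≢τ rewrite nonzero-⊕ σ τ σ≢τ =
  trans (ℚ.*-identityˡ _) (∏-orthogonal-⊕ φ σ⊨φ τ⊨φ)

0≤kernel : ∀ {n m} (x : Vec Bool n) (φ : Formula n m) → 0ℚ ≤ kernel x φ
0≤kernel x φ = 0≤* (0≤indicator (nonzero x)) (0≤∏ φ)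
  where
  0≤∏ : ∀ {m} (φ : Formula _ m) → 0ℚ ≤ ∏ (orthogonal x) φ
  0≤∏ []      = 0≤1
  0≤∏ (C ∷ φ) = 0≤* (0≤indicator (not (dot (vars C) x))) (0≤∏ φ)

-- Summing over all x with weight r ^ ∣ x ∣ is an expectation against an
-- iid vector with the (unnormalised) weights r and 1 for true and false.
weights : ℚ → Dist Bool
weights r = (true , fromℚ r) ∷ (false , 1ℝ) ∷ []

-- The weighted union bound at a fixed coordinate.

module _ (j : ℕ) where

  𝔼-nonNeg : ∀ {A} {d : Dist A} → Monotone j d → ∀ {f} → (∀ a → 0ℚ ≤ f a) → 0ℚ ≤ 𝔼 j d f
  𝔼-nonNeg {d = d} mono {f} 0≤f = subst (_≤ 𝔼 j d f) (𝔼-zero j d) (𝔼-mono mono 0≤f)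

  weights-monotone : ∀ {r} → 0ℚ ≤ r → Monotone j (weights r)
  weights-monotone {r} 0≤r = 
    ∷-monotone j 0≤r (∷-monotone j 0≤1 ([]-monotone j))

  -- A sum of nonnegative terms dominates each of them. The induction splits on the first bit and
  -- discards the half of the sum with the other bit.
  term≤𝔼 : ∀ {r} → 0ℚ ≤ r → ∀ n {f} → (∀ x → 0ℚ ≤ f x) → ∀ x →
           r ^ ∣ x ∣ * f x ≤ 𝔼 j (iid n (weights r)) f
  term≤𝔼 0≤r zero {f} 0≤f [] =
    ℚ.≤-reflexive (trans (ℚ.*-identityˡ (f [])) (sym (𝔼-pure j [] f)))
  term≤𝔼 {r} 0≤r (suc n) {f} 0≤f (b ∷ x) =
    subst (r ^ ∣ b ∷ x ∣ * f (b ∷ x) ≤_) (sym (𝔼-iid-suc j n (weights r) f)) (bound b)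
    where
    open ℚ.≤-Reasoning
    S : Bool → ℚ
    S b = 𝔼 j (iid n (weights r)) (λ x → f (b ∷ x))
    0≤S : ∀ b → 0ℚ ≤ S b
    0≤S b = 𝔼-nonNeg (iid-monotone j n (weights-monotone 0≤r)) (λ x → 0≤f (b ∷ x))
    bound : ∀ b → r ^ ∣ b ∷ x ∣ * f (b ∷ x) ≤ r * S true + (1ℚ * S false + 0ℚ)
    bound true = begin
      r * r ^ ∣ x ∣ * f (true ∷ x)
        ≡⟨ ℚ.*-assoc r _ _ ⟩
      r * (r ^ ∣ x ∣ * f (true ∷ x))
        ≤⟨ *-monoˡ-≤ r 0≤r (term≤𝔼 0≤r n (λ x → 0≤f (true ∷ x)) x) ⟩
      r * S true
        ≡⟨ ℚ.+-identityʳ (r * S true) ⟨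
      r * S true + 0ℚ
        ≤⟨ ℚ.+-monoʳ-≤ (r * S true) (0≤+ (0≤* 0≤1 (0≤S false)) ℚ.≤-refl) ⟩
      r * S true + (1ℚ * S false + 0ℚ) ∎
    bound false = begin
      r ^ ∣ x ∣ * f (false ∷ x)
        ≤⟨ term≤𝔼 0≤r n (λ x → 0≤f (false ∷ x)) x ⟩
      S false
        ≡⟨ unit (S false) ⟩
      0ℚ + (1ℚ * S false + 0ℚ)
        ≤⟨ ℚ.+-monoˡ-≤ (1ℚ * S false + 0ℚ) (0≤* 0≤r (0≤S true)) ⟩
      r * S true + (1ℚ * S false + 0ℚ) ∎
      where
      unit : ∀ a → a ≡ 0ℚ + (1ℚ * a + 0ℚ)
      unit = solve-∀ ℚ-ring

  module _ (p : ℝ) where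

    bernoulli-mass : 𝔼 j (bernoulli p) (λ _ → 1ℚ) ≡ 1ℚ
    bernoulli-mass = sum-1 (seq p j)
      where
      sum-1 : ∀ p → p * 1ℚ + ((1ℚ - p) * 1ℚ + 0ℚ) ≡ 1ℚ
      sum-1 = solve-∀ ℚ-ring

    bernoulli-monotone : 0ℚ ≤ seq p j → seq p j ≤ 1ℚ → Monotone j (bernoulli p)
    bernoulli-monotone 0≤p p≤1 =
      ∷-monotone j 0≤p (∷-monotone j (≤⇒0≤- p≤1) ([]-monotone j))

  module _ (p : ℝ) (θ : ℚ) (p≤θ : seq p j ≤ θ) (1-p≤θ : 1ℚ - seq p j ≤ θ)
           (0≤p : 0ℚ ≤ seq p j) (p≤1 : seq p j ≤ 1ℚ) where

    -- For x = true ∷ x′ the first entry of S decides whether S is orthogonal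
    -- to x, whatever the other entries are.
    𝔼-orthogonal : ∀ n (x : Vec Bool n) → nonzero x ≡ true →
      𝔼 j (iid n (bernoulli p)) (λ S → indicator (not (dot S x))) ≤ θ
    𝔼-orthogonal (suc n) (false ∷ x) x≢0 =
      subst (_≤ θ) (sym unfold) (𝔼-orthogonal n x x≢0)
      where
      open ≡-Reasoning
      unfold : 𝔼 j (iid (suc n) (bernoulli p)) (λ S → indicator (not (dot S (false ∷ x)))) ≡
               𝔼 j (iid n (bernoulli p)) (λ S → indicator (not (dot S x)))
      unfold = begin
        _ ≡⟨ 𝔼-iid-suc j n (bernoulli p) _ ⟩
        _ ≡⟨ 𝔼-cong j (bernoulli p) (λ a → cong (λ b → 𝔼 j (iid n (bernoulli p))
               (λ S → indicator (not (b xor dot S x)))) (Bool.∧-zeroʳ a)) ⟩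
        _ ≡⟨ 𝔼-const j (bernoulli p) _ (bernoulli-mass p) ⟩
        _ ∎
    𝔼-orthogonal (suc n) (true ∷ x) _ =
      subst (_≤ θ) (sym (𝔼-iid-suc j n (bernoulli p) _)) (begin
        seq p j * U + ((1ℚ - seq p j) * V + 0ℚ)
          ≤⟨ ℚ.+-mono-≤ (*-monoʳ-≤ U 0≤U p≤θ) (ℚ.+-monoˡ-≤ 0ℚ (*-monoʳ-≤ V 0≤V 1-p≤θ)) ⟩
        θ * U + (θ * V + 0ℚ)
          ≡⟨ factor θ U V ⟩
        θ * (U + V)
          ≡⟨ cong (λ z → θ * z) U+V≡1 ⟩
        θ * 1ℚ
          ≡⟨ ℚ.*-identityʳ θ ⟩
        θ ∎)
      where
      open ℚ.≤-Reasoning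
      d : Dist (Vec Bool n)
      d = iid n (bernoulli p)
      -- `U` and `V` are the probabilities that the remaining entries require the first entry to be
      -- `true` or `false`, respectively.
      U V : ℚ
      U = 𝔼 j d (λ S → indicator (not (not (dot S x))))
      V = 𝔼 j d (λ S → indicator (not (dot S x)))
      mono : Monotone j d
      mono = iid-monotone j n (bernoulli-monotone p 0≤p p≤1)
      0≤U : 0ℚ ≤ U
      0≤U = 𝔼-nonNeg mono (λ S → 0≤indicator (not (not (dot S x))))
      0≤V : 0ℚ ≤ V
      0≤V = 𝔼-nonNeg mono (λ S → 0≤indicator (not (dot S x)))
      complement : ∀ b → indicator (not b) + indicator b ≡ 1ℚ
      complement true  = refl
      complement false = refl
      U+V≡1 : U + V ≡ 1ℚ
      U+V≡1 = trans (sym (𝔼-+ j d _ _)) (trans (𝔼-cong j d (λ S → complement (not (dot S x))))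
                (𝔼-iid-mass-1 j n (bernoulli p) (bernoulli-mass p)))
      factor : ∀ t u v → t * u + (t * v + 0ℚ) ≡ t * (u + v)
      factor = solve-∀ ℚ-ring

    withConstant : ∀ {n} → Vec Bool n → Dist (Clause n)
    withConstant S = bernoulli ½ℝ >>= λ c → pure (clause c S)

    -- A function of the variables alone does not depend on the random constant, which therefore
    -- integrates out with mass 1.
    𝔼-randomClause : ∀ n (f : Vec Bool n → ℚ) →
      𝔼 j (randomClause p n) (λ C → f (vars C)) ≡ 𝔼 j (iid n (bernoulli p)) f
    𝔼-randomClause n f =
      trans (𝔼->>= j (iid n (bernoulli p)) withConstant (f ∘ vars)) (𝔼-cong j (iid n (bernoulli p)) λ S →
      trans (𝔼->>= j (bernoulli ½ℝ) (λ c → pure (clause c S)) (f ∘ vars))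
      (trans (𝔼-cong j (bernoulli ½ℝ) (λ c → 𝔼-pure j (clause c S) (f ∘ vars)))
      (𝔼-const j (bernoulli ½ℝ) (f S) (bernoulli-mass ½ℝ))))

    randomClause-monotone : ∀ n → Monotone j (randomClause p n)
    randomClause-monotone n =
      >>=-monotone j (iid n (bernoulli p)) withConstant (iid-monotone j n (bernoulli-monotone p 0≤p p≤1)) λ S →
      >>=-monotone j (bernoulli ½ℝ) (λ c → pure (clause c S)) (bernoulli-monotone ½ℝ (ℚ.nonNegative⁻¹ ½) (ℚ.*≤* (ℤ.+≤+ (ℕ.s≤s ℕ.z≤n)))) λ c →
      pure-monotone j

    Q-monotone : ∀ n m → Monotone j (Q p n m)
    Q-monotone n m = iid-monotone j m (randomClause-monotone n)

    Q-mass : ∀ n m → 𝔼 j (Q p n m) (λ _ → 1ℚ) ≡ 1ℚ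
    Q-mass n m = 𝔼-iid-mass-1 j m (randomClause p n)
      (trans (𝔼-randomClause n (λ _ → 1ℚ)) (𝔼-iid-mass-1 j n (bernoulli p) (bernoulli-mass p)))

    -- For nonzero `x` the clauses contribute independent factors, each at most `θ` by
    -- `𝔼-orthogonal`. For the zero vector the factor `indicator (nonzero x)` vanishes, so the bound
    -- is uniform in `x` and can be summed.
    𝔼-kernel : ∀ n m (x : Vec Bool n) → 𝔼 j (Q p n m) (kernel x) ≤ θ ^ m
    𝔼-kernel n m x = subst (_≤ θ ^ m) (sym (𝔼-*ˡ j (Q p n m) (indicator (nonzero x)) _)) (bound (nonzero x) refl)
      where
      open ℚ.≤-Reasoning
      0≤θ : 0ℚ ≤ θ
      0≤θ = ℚ.≤-trans 0≤p p≤θ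
      bound : ∀ b → nonzero x ≡ b → indicator b * 𝔼 j (Q p n m) (∏ (orthogonal x)) ≤ θ ^ m
      bound false _   = ℚ.≤-trans (ℚ.≤-reflexive (ℚ.*-zeroˡ (𝔼 j (Q p n m) (∏ (orthogonal x))))) (^-nonNeg 0≤θ m)
      bound true  x≢0 = begin
        1ℚ * 𝔼 j (Q p n m) (∏ (orthogonal x))
          ≡⟨ ℚ.*-identityˡ _ ⟩
        𝔼 j (Q p n m) (∏ (orthogonal x))
          ≡⟨ 𝔼-iid-∏ j m (randomClause p n) (orthogonal x) ⟩
        𝔼 j (randomClause p n) (orthogonal x) ^ m
          ≡⟨ cong (_^ m) (𝔼-randomClause n (λ S → indicator (not (dot S x)))) ⟩
        𝔼 j (iid n (bernoulli p)) (λ S → indicator (not (dot S x))) ^ m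
          ≤⟨ ^-monoˡ-≤ (𝔼-nonNeg (iid-monotone j n (bernoulli-monotone p 0≤p p≤1))
                          (λ S → 0≤indicator (not (dot S x))))
               (𝔼-orthogonal n x x≢0) m ⟩
        θ ^ m ∎

    -- The factor `(1ℚ + r) ^ n` is the sum of `r ^ ∣ x ∣` over all `x`: the binomial theorem,
    -- obtained here as the mass of `n` independent copies of `weights r`.
    Σ-𝔼-kernel : ∀ {r} → 0ℚ ≤ r → ∀ n m →
      𝔼 j (iid n (weights r)) (λ x → 𝔼 j (Q p n m) (kernel x)) ≤ (1ℚ + r) ^ n * θ ^ m
    Σ-𝔼-kernel {r} 0≤r n m = begin
      𝔼 j d (λ x → 𝔼 j (Q p n m) (kernel x))
        ≤⟨ 𝔼-mono (iid-monotone j n (weights-monotone 0≤r)) (𝔼-kernel n m) ⟩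
      𝔼 j d (λ _ → θ ^ m)
        ≡⟨ 𝔼-cong j d (λ _ → sym (ℚ.*-identityˡ (θ ^ m))) ⟩
      𝔼 j d (λ _ → 1ℚ * θ ^ m)
        ≡⟨ 𝔼-*ʳ j d (θ ^ m) (λ _ → 1ℚ) ⟩
      𝔼 j d (λ _ → 1ℚ) * θ ^ m
        ≡⟨ cong (_* θ ^ m) (𝔼-iid-mass j n (weights r)) ⟩
      𝔼 j (weights r) (λ _ → 1ℚ) ^ n * θ ^ m
        ≡⟨ cong (λ z → z ^ n * θ ^ m) (mass r) ⟩
      (1ℚ + r) ^ n * θ ^ m ∎
      where
      open ℚ.≤-Reasoning
      d : Dist (Vec Bool n)
      d = iid n (weights r)
      mass : ∀ r → r * 1ℚ + (1ℚ * 1ℚ + 0ℚ) ≡ 1ℚ + r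
      mass = solve-∀ ℚ-ring

    -- The union bound, multiplied through by `q ^ n` so that only natural exponents occur. The
    -- event `E` is arbitrary, which keeps comparisons of real numbers out of the probabilistic
    -- argument.
    Pr-bound : ∀ {q} → 0ℚ ≤ q → q ≤ 1ℚ → ∀ L n m {E : Formula n m → Set} (E? : ∀ φ → Dec (E φ)) →
      (∀ φ → (∀ σ τ → IsSolution φ σ → IsSolution φ τ → σ ≢ τ → ¬ (L ℕ.* hamming σ τ ℕ.≤ n)) → E φ) →
      q ^ n ≤ q ^ n * seq (Pr (Q p n m) E?) j + (1ℚ + q ^ L) ^ n * θ ^ m
    Pr-bound {q} 0≤q q≤1 L n m {E} E? far⇒E = begin
      q ^ n
        ≡⟨ 𝔼-const j (Q p n m) (q ^ n) (Q-mass n m) ⟨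
      𝔼 j (Q p n m) (λ _ → q ^ n)
        ≤⟨ 𝔼-mono (Q-monotone n m) pointwise ⟩
      𝔼 j (Q p n m) (λ φ → q ^ n * indicator (does (E? φ)) + K φ)
        ≡⟨ 𝔼-+ j (Q p n m) _ _ ⟩
      𝔼 j (Q p n m) (λ φ → q ^ n * indicator (does (E? φ))) + 𝔼 j (Q p n m) K
        ≡⟨ cong₂ _+_ (𝔼-*ˡ j (Q p n m) (q ^ n) _) (𝔼-swap j (Q p n m) (iid n (weights r)) (λ φ x → kernel x φ)) ⟩
      q ^ n * 𝔼 j (Q p n m) (λ φ → indicator (does (E? φ))) + 𝔼 j (iid n (weights r)) (λ x → 𝔼 j (Q p n m) (kernel x))
        ≡⟨ cong (λ z → q ^ n * z + 𝔼 j (iid n (weights r)) (λ x → 𝔼 j (Q p n m) (kernel x))) (Pr-𝔼 j (Q p n m) E?) ⟨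
      q ^ n * seq (Pr (Q p n m) E?) j + 𝔼 j (iid n (weights r)) (λ x → 𝔼 j (Q p n m) (kernel x))
        ≤⟨ ℚ.+-monoʳ-≤ (q ^ n * seq (Pr (Q p n m) E?) j) (Σ-𝔼-kernel 0≤r n m) ⟩
      q ^ n * seq (Pr (Q p n m) E?) j + (1ℚ + r) ^ n * θ ^ m ∎
      where
      open ℚ.≤-Reasoning
      r : ℚ
      r = q ^ L
      0≤r : 0ℚ ≤ r
      0≤r = ^-nonNeg 0≤q L
      K : Formula n m → ℚ
      K φ = 𝔼 j (iid n (weights r)) (λ x → kernel x φ)
      0≤K : ∀ φ → 0ℚ ≤ K φ
      0≤K φ = 𝔼-nonNeg (iid-monotone j n (weights-monotone 0≤r)) (λ x → 0≤kernel x φ)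
      -- A single light vector suffices: `L * ∣ σ ⊕ τ ∣ ≤ n` and `q ≤ 1` make its term in `K φ` at
      -- least `q ^ n`.
      close⇒≤K : ∀ φ σ τ → IsSolution φ σ → IsSolution φ τ → σ ≢ τ → L ℕ.* hamming σ τ ℕ.≤ n → q ^ n ≤ K φ
      close⇒≤K φ σ τ σ⊨φ τ⊨φ σ≢τ close = begin
        q ^ n
          ≤⟨ ^-antitoneʳ 0≤q q≤1 close ⟩
        q ^ (L ℕ.* hamming σ τ)
          ≡⟨ cong (λ h → q ^ (L ℕ.* h)) (hamming-⊕ σ τ) ⟩
        q ^ (L ℕ.* ∣ σ ⊕ τ ∣)
          ≡⟨ ^-assocʳ q L ∣ σ ⊕ τ ∣ ⟨
        r ^ ∣ σ ⊕ τ ∣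
          ≡⟨ ℚ.*-identityʳ _ ⟨
        r ^ ∣ σ ⊕ τ ∣ * 1ℚ
          ≡⟨ cong (λ z → r ^ ∣ σ ⊕ τ ∣ * z) (kernel-⊕ φ σ⊨φ τ⊨φ σ≢τ) ⟨
        r ^ ∣ σ ⊕ τ ∣ * kernel (σ ⊕ τ) φ
          ≤⟨ term≤𝔼 0≤r n (λ x → 0≤kernel x φ) (σ ⊕ τ) ⟩
        K φ ∎
      pointwise : ∀ φ → q ^ n ≤ q ^ n * indicator (does (E? φ)) + K φ
      pointwise φ with E? φ
      ... | yes _ = begin
        q ^ n                 ≡⟨ unit (q ^ n) ⟩
        q ^ n * 1ℚ + 0ℚ       ≤⟨ ℚ.+-monoʳ-≤ (q ^ n * 1ℚ) (0≤K φ) ⟩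
        q ^ n * 1ℚ + K φ      ∎
        where
        unit : ∀ a → a ≡ a * 1ℚ + 0ℚ
        unit = solve-∀ ℚ-ring
      -- Deciding this rational inequality replaces a search for a close pair: if it fails,
      -- `close⇒≤K` excludes every such pair and `E φ` follows.
      ... | no ¬Eφ with q ^ n ℚ.≤? K φ
      ...   | no  ≰K = contradiction
        (far⇒E φ λ σ τ σ⊨φ τ⊨φ σ≢τ close → ≰K (close⇒≤K φ σ τ σ⊨φ τ⊨φ σ≢τ close)) ¬Eφ
      ...   | yes ≤K = begin
        q ^ n                 ≤⟨ ≤K ⟩
        K φ                   ≡⟨ unit (q ^ n) (K φ) ⟩
        q ^ n * 0ℚ + K φ      ∎
        where
        unit : ∀ a b → b ≡ a * 0ℚ + b
        unit = solve-∀ ℚ-ring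

    Pr≤1 : ∀ n m {E : Formula n m → Set} (E? : ∀ φ → Dec (E φ)) → seq (Pr (Q p n m) E?) j ≤ 1ℚ
    Pr≤1 n m E? = subst₂ _≤_ (sym (Pr-𝔼 j (Q p n m) E?)) (Q-mass n m)
      (𝔼-mono (Q-monotone n m) (λ φ → indicator≤1 (does (E? φ))))

-- Deciding separation at a rational threshold.

≤⇒≤ℝ : ∀ {a b} → a ≤ b → fromℚ a ≤ℝ fromℚ b
≤⇒≤ℝ {a} {b} a≤b ε 0<ε = 0 , λ _ _ → begin
  a         ≤⟨ a≤b ⟩
  b         ≡⟨ ℚ.+-identityʳ b ⟨
  b + 0ℚ    ≤⟨ ℚ.+-monoʳ-≤ b (ℚ.<⇒≤ 0<ε) ⟩
  b + ε     ∎
  where open ℚ.≤-Reasoning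

-- If `b < a`, take `c` strictly between them; the slack `c - b` in `_≤ℝ_` then forces `a ≤ c`.
≤ℝ⇒≤ : ∀ {a b} → fromℚ a ≤ℝ fromℚ b → a ≤ b
≤ℝ⇒≤ {a} {b} a≤b with a ℚ.≤? b
... | yes a≤b = a≤b
... | no  a≰b =
  let (c , b<c , c<a) = ℚ.<-dense (ℚ.≰⇒> a≰b)
      0<c-b           = subst (_< c - b) (ℚ.+-inverseʳ b) (ℚ.+-monoˡ-< (ℚ.- b) b<c)
      (N , h)         = a≤b (c - b) 0<c-b
  in contradiction (ℚ.<-≤-trans c<a (subst (a ≤_) (cancel b c) (h N ℕ.≤-refl))) (ℚ.<-irrefl refl)
  where
  cancel : ∀ b c → b + (c - b) ≡ c
  cancel = solve-∀ ℚ-ring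

-- A Boolean vector is a `Subset`, so `anySubset?` can search for a counterexample.
allAssignments? : ∀ {n} {P : Vec Bool n → Set} → (∀ x → Dec (P x)) → Dec (∀ x → P x)
allAssignments? P? = map′
  (λ ¬∃¬P x → decidable-stable (P? x) (λ ¬Px → ¬∃¬P (x , ¬Px)))
  (λ ∀P (x , ¬Px) → ¬Px (∀P x))
  (¬? (anySubset? (¬? ∘ P?)))

abstract
  -- Between constant sequences `_≤ℝ_` reduces to the decidable order of ℚ. For this reason the
  -- separation function of the theorem takes rational values.
  separated? : ∀ a {n m} (φ : Formula n m) → Dec (Separated (fromℚ a) φ)
  separated? a φ = allAssignments? λ σ → allAssignments? λ τ →
    solution? σ →-dec solution? τ →-dec ¬? (≡-dec Bool._≟_ σ τ) →-dec
    map′ ≤⇒≤ℝ ≤ℝ⇒≤ (a ℚ.≤? ι (hamming σ τ))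
    where
    solution? : ∀ σ → Dec (IsSolution φ σ)
    solution? σ = All.all? (λ C → eval C σ Bool.≟ true) φ

-- Decay of the failure probability.

abstract
  common-lower-bound : ∀ {a b} → 0ℚ < a → 0ℚ < b → ∃[ c ] (0ℚ < c × c ≤ a × c ≤ b)
  common-lower-bound {a} {b} 0<a 0<b with ℚ.≤-total a b
  ... | inj₁ a≤b = a , 0<a , ℚ.≤-refl , a≤b
  ... | inj₂ b≤a = b , 0<b , b≤a , ℚ.≤-refl

-- Since n ≤ K (m + 1), the decay q ^ (4 K m) of θ ^ m beats the factor
-- q ^ (- 2 n) that comes from the number of light vectors.
½*defect≤ : ∀ {q θ r P n m K} → 0ℚ < q → q ≤ 1ℚ → ½ ≤ θ → θ ≤ q ^ (4 ℕ.* K) → 0ℚ ≤ r →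
  q * (1ℚ + r) ≤ 1ℚ → n ℕ.≤ K ℕ.* suc m → P ≤ 1ℚ →
  q ^ n ≤ q ^ n * P + (1ℚ + r) ^ n * θ ^ m → ½ * (1ℚ - P) ≤ q ^ n
½*defect≤ {q} {θ} {r} {P} {n} {m} {K} 0<q q≤1 ½≤θ θ≤c 0≤r q[1+r]≤1 n≤K[1+m] P≤1 bound =
  begin
    -- The factor `c ≥ ½` turns `c ^ m` into `c ^ suc m`, matching the `suc m` in `n ≤ K * suc m`;
    -- its cost is the ½ in the conclusion.
    ½ * (1ℚ - P)       ≤⟨ *-monoʳ-≤ (1ℚ - P) (≤⇒0≤- P≤1) (ℚ.≤-trans ½≤θ θ≤c) ⟩
    c * (1ℚ - P)       ≤⟨ ℚ.*-cancelˡ-≤-pos (u * u) {{ℚ.positive (0<* 0<u 0<u)}} scaled ⟩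
    u * u              ≤⟨ *-monoˡ-≤ u (ℚ.<⇒≤ 0<u) (^-≤1 0≤q q≤1 n) ⟩
    u * 1ℚ             ≡⟨ ℚ.*-identityʳ u ⟩
    u                  ∎
  where
  open ℚ.≤-Reasoning
  u c : ℚ
  u = q ^ n
  c = q ^ (4 ℕ.* K)
  0≤q : 0ℚ ≤ q
  0≤q = ℚ.<⇒≤ 0<q
  0<u : 0ℚ < u
  0<u = ^-pos 0<q n
  0≤θ : 0ℚ ≤ θ
  0≤θ = ℚ.≤-trans (ℚ.nonNegative⁻¹ ½) ½≤θ
  0≤c : 0ℚ ≤ c
  0≤c = ℚ.≤-trans 0≤θ θ≤c
  rearrange : ∀ u p x → u * p + x - u ≡ x - u * (1ℚ - p)
  rearrange = solve-∀ ℚ-ring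
  u[1-P]≤ : u * (1ℚ - P) ≤ (1ℚ + r) ^ n * θ ^ m
  u[1-P]≤ = 0≤-⇒≤ (subst (0ℚ ≤_) (rearrange u P ((1ℚ + r) ^ n * θ ^ m)) (≤⇒0≤- bound))
  regroup : ∀ u c d → u * u * (c * d) ≡ c * (u * (u * d))
  regroup = solve-∀ ℚ-ring
  power-4 : u * u * (u * u) ≡ q ^ (4 ℕ.* n)
  power-4 = begin-equality
    u * u * (u * u)                  ≡⟨ cong₂ _*_ (^-homo-* q n n) (^-homo-* q n n) ⟨
    q ^ (n ℕ.+ n) * q ^ (n ℕ.+ n)    ≡⟨ ^-homo-* q (n ℕ.+ n) (n ℕ.+ n) ⟨
    q ^ (n ℕ.+ n ℕ.+ (n ℕ.+ n))      ≡⟨ cong (q ^_) (fourfold n) ⟩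
    q ^ (4 ℕ.* n)                    ∎
    where
    fourfold : ∀ n → n ℕ.+ n ℕ.+ (n ℕ.+ n) ≡ 4 ℕ.* n
    fourfold = ℕ-Solver.solve-∀
  -- One factor `u` is used by the union bound, the other absorbs `(1ℚ + r) ^ n` because
  -- `q * (1ℚ + r) ≤ 1ℚ`. Cancelling both from the fourth power on the right still leaves `u * u`.
  scaled : u * u * (c * (1ℚ - P)) ≤ u * u * (u * u)
  scaled = begin
    u * u * (c * (1ℚ - P))
      ≡⟨ regroup u c (1ℚ - P) ⟩
    c * (u * (u * (1ℚ - P)))
      ≤⟨ *-monoˡ-≤ c 0≤c (*-monoˡ-≤ u (ℚ.<⇒≤ 0<u) u[1-P]≤) ⟩
    c * (u * ((1ℚ + r) ^ n * θ ^ m))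
      ≡⟨ cong (λ z → c * z) (ℚ.*-assoc u ((1ℚ + r) ^ n) (θ ^ m)) ⟨
    c * (u * (1ℚ + r) ^ n * θ ^ m)
      ≡⟨ cong (λ z → c * (z * θ ^ m)) (^-distrib-* q (1ℚ + r) n) ⟨
    c * ((q * (1ℚ + r)) ^ n * θ ^ m)
      ≤⟨ *-monoˡ-≤ c 0≤c (*-mono-≤ 0≤1 (^-nonNeg 0≤θ m)
           (^-≤1 (0≤* 0≤q (0≤+ 0≤1 0≤r)) q[1+r]≤1 n) (^-monoˡ-≤ 0≤θ θ≤c m)) ⟩
    c * (1ℚ * c ^ m)
      ≡⟨ cong (λ z → c * z) (ℚ.*-identityˡ (c ^ m)) ⟩
    c ^ suc m
      ≡⟨ ^-assocʳ q (4 ℕ.* K) (suc m) ⟩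
    q ^ (4 ℕ.* K ℕ.* suc m)
      ≡⟨ cong (q ^_) (ℕ.*-assoc 4 K (suc m)) ⟩
    q ^ (4 ℕ.* (K ℕ.* suc m))
      ≤⟨ ^-antitoneʳ 0≤q q≤1 (ℕ.*-monoʳ-≤ 4 n≤K[1+m]) ⟩
    q ^ (4 ℕ.* n)
      ≡⟨ power-4 ⟨
    u * u * (u * u) ∎

abstract
  -- With a rational `σ` eventually below `s` and `K ≥ 1 / σ`, one has n ≤ Kσn ≤ Ksn ≤ K(m + 1) at a
  -- late coordinate. The added 1 is the slack that `_≤ℝ_` requires, chosen so that the bound stays
  -- a natural number.
  ceiling-lower-bound : ∀ {s} → 0ℝ <ℝ s →
    ∃[ K ] (∀ n m → IsCeiling (s *ℝ fromℕ n) m → n ℕ.≤ K ℕ.* suc m)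
  ceiling-lower-bound {s} (σ , 0<σ , N , σ≤s) = K , bound
    where
    open ℚ.≤-Reasoning
    K : ℕ
    K = proj₁ (archimedean 0<σ)
    bound : ∀ n m → IsCeiling (s *ℝ fromℕ n) m → n ℕ.≤ K ℕ.* suc m
    bound n m (sn≤m , _) =
      let (N′ , sn≤m+1) = sn≤m 1ℚ (ℚ.positive⁻¹ 1ℚ)
          j             = N ℕ.⊔ N′
      in ι-cancel-≤ (begin
        ι n                      ≡⟨ ℚ.*-identityˡ (ι n) ⟨
        1ℚ * ι n                 ≤⟨ *-monoʳ-≤ (ι n) (0≤ι n) (proj₂ (archimedean 0<σ)) ⟩
        ι K * σ * ι n            ≡⟨ ℚ.*-assoc (ι K) σ (ι n) ⟩
        ι K * (σ * ι n)          ≡⟨ cong (λ z → ι K * (z * ι n)) (ℚ.+-identityˡ σ) ⟨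
        ι K * ((0ℚ + σ) * ι n)   ≤⟨ *-monoˡ-≤ (ι K) (0≤ι K) (*-monoʳ-≤ (ι n) (0≤ι n) (σ≤s j (ℕ.m≤m⊔n N N′))) ⟩
        ι K * (seq s j * ι n)    ≤⟨ *-monoˡ-≤ (ι K) (0≤ι K) (sn≤m+1 j (ℕ.m≤n⊔m N N′)) ⟩
        ι K * (ι m + 1ℚ)         ≡⟨ cong (λ z → ι K * z) (ℚ.+-comm (ι m) 1ℚ) ⟩
        ι K * (1ℚ + ι m)         ≡⟨ cong (λ z → ι K * z) (ι-suc m) ⟨
        ι K * ι (suc m)          ≡⟨ ι-* K (suc m) ⟨
        ι (K ℕ.* suc m)          ∎)

-- Choice of the constants and convergence.

¼ : ℚ
¼ = + 1 ℚ./ 4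

corollary3 : (s p : ℝ) → 0ℝ <ℝ s → s <ℝ 1ℝ → 0ℝ <ℝ p → p ≤ℝ ½ℝ →
    (⌈sn⌉ : ℕ → ℕ) → (∀ n → IsCeiling (s *ℝ fromℕ n) (⌈sn⌉ n)) →
    Σ[ g ∈ (ℕ → ℝ) ] (IsΩ[n] g ×
    WithHighProbability (λ n → Q p n (⌈sn⌉ n)) (λ n φ → Separated (g n) φ))
corollary3 s p 0<s s<1 (ε₁ , 0<ε₁ , N₁ , ε₁≤p) p≤½ ⌈sn⌉ isCeiling =
    g , (fromℚ γ , (γ , 0<γ , 0 , λ _ _ → ℚ.≤-reflexive (ℚ.+-identityˡ γ)) ,
         0 , λ n _ → ≤⇒≤ℝ ℚ.≤-refl)
      , E? , converges
  where
  open ℚ.≤-Reasoning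
  K : ℕ
  K = proj₁ (ceiling-lower-bound {s} 0<s)
  -- The bound `ε₁` gives `1 - p ≤ θ`. The bound `¼` gives `½ ≤ θ`, and also `p ≤ θ`, because at a
  -- late coordinate `p ≤ ½` is available only up to a slack, taken to be `¼`.
  ε-choice : ∃[ ε ] (0ℚ < ε × ε ≤ ε₁ × ε ≤ ¼)
  ε-choice = common-lower-bound 0<ε₁ (ℚ.positive⁻¹ ¼)
  ε θ δ q γ : ℚ
  ε = proj₁ ε-choice
  θ = 1ℚ - ε
  0<ε : 0ℚ < ε
  0<ε = proj₁ (proj₂ ε-choice)
  ε≤ε₁ : ε ≤ ε₁
  ε≤ε₁ = proj₁ (proj₂ (proj₂ ε-choice))
  ε≤¼ : ε ≤ ¼
  ε≤¼ = proj₂ (proj₂ (proj₂ ε-choice))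
  -- Dividing `ε` by 4K + 1 gives 4Kδ ≤ ε, from which Bernoulli's inequality yields
  -- `θ ≤ q ^ (4 ℕ.* K)`, and at the same time `δ ≤ ε ≤ ¼`.
  δ-choice : ∃[ δ ] (0ℚ < δ × ι (suc (4 ℕ.* K)) * δ ≡ ε)
  δ-choice = equal-parts 0<ε (4 ℕ.* K)
  δ = proj₁ δ-choice
  0<δ : 0ℚ < δ
  0<δ = proj₁ (proj₂ δ-choice)
  0≤δ : 0ℚ ≤ δ
  0≤δ = ℚ.<⇒≤ 0<δ
  parts : ∀ k → k ℕ.≤ suc (4 ℕ.* K) → ι k * δ ≤ ε
  parts k k≤ = ℚ.≤-trans (*-monoʳ-≤ δ 0≤δ (ι-mono-≤ k≤)) (ℚ.≤-reflexive (proj₂ (proj₂ δ-choice)))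
  δ≤¼ : δ ≤ ¼
  δ≤¼ = ℚ.≤-trans (ℚ.≤-reflexive (sym (ℚ.*-identityˡ δ))) (ℚ.≤-trans (parts 1 (ℕ.s≤s ℕ.z≤n)) ε≤¼)
  ¼<1 : ¼ < 1ℚ
  ¼<1 = ℚ.*<* (ℤ.+<+ (ℕ.s≤s (ℕ.s≤s ℕ.z≤n)))
  δ<1 : δ < 1ℚ
  δ<1 = ℚ.≤-<-trans δ≤¼ ¼<1
  δ≤1 : δ ≤ 1ℚ
  δ≤1 = ℚ.<⇒≤ δ<1
  q = 1ℚ - δ
  0<q : 0ℚ < q
  0<q = subst (_< q) (ℚ.+-inverseʳ δ) (ℚ.+-monoˡ-< (ℚ.- δ) δ<1)
  0≤q : 0ℚ ≤ q
  0≤q = ℚ.<⇒≤ 0<q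
  q≤1 : q ≤ 1ℚ
  q≤1 = ℚ.+-monoʳ-≤ 1ℚ (ℚ.neg-antimono-≤ 0≤δ)
  1-antitone : ∀ {a b} → a ≤ b → 1ℚ - b ≤ 1ℚ - a
  1-antitone a≤b = ℚ.+-monoʳ-≤ 1ℚ (ℚ.neg-antimono-≤ a≤b)
  θ≤q^4K : θ ≤ q ^ (4 ℕ.* K)
  θ≤q^4K = ℚ.≤-trans (1-antitone (parts (4 ℕ.* K) (ℕ.n≤1+n (4 ℕ.* K)))) (bernoulli-≤ 0≤δ δ≤1 (4 ℕ.* K))
  ½≤θ : ½ ≤ θ
  ½≤θ = ℚ.≤-trans (ℚ.*≤* (ℤ.+≤+ (ℕ.m≤m+n 4 2))) (1-antitone ε≤¼)
  -- Once `q ^ L ≤ δ`, the product `q * (1ℚ + q ^ L)` is at most (1 - δ)(1 + δ) ≤ 1. The `suc` in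
  -- `L` makes it positive, so that `γ` can be 1 / L.
  L-choice : ∃[ N ] (∀ n → N ℕ.≤ n → q ^ n ≤ δ)
  L-choice = ^-vanishes 0<δ δ≤1 0<δ
  L : ℕ
  L = suc (proj₁ L-choice)
  q[1+q^L]≤1 : q * (1ℚ + q ^ L) ≤ 1ℚ
  q[1+q^L]≤1 = begin
    q * (1ℚ + q ^ L)    ≤⟨ *-monoˡ-≤ q 0≤q (ℚ.+-monoʳ-≤ 1ℚ (proj₂ L-choice L (ℕ.n≤1+n _))) ⟩
    q * (1ℚ + δ)        ≤⟨ 0≤-⇒≤ (subst (0ℚ ≤_) (square δ) (0≤* 0≤δ 0≤δ)) ⟩
    1ℚ                  ∎
    where
    square : ∀ δ → δ * δ ≡ 1ℚ - (1ℚ - δ) * (1ℚ + δ)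
    square = solve-∀ ℚ-ring
  γ-choice : ∃[ γ ] (0ℚ < γ × ι L * γ ≡ 1ℚ)
  γ-choice = equal-parts (ℚ.positive⁻¹ 1ℚ) (proj₁ L-choice)
  γ = proj₁ γ-choice
  0<γ : 0ℚ < γ
  0<γ = proj₁ (proj₂ γ-choice)
  g : ℕ → ℝ
  g n = fromℚ (γ * ι n)
  E? : ∀ n (φ : Formula n (⌈sn⌉ n)) → Dec (Separated (g n) φ)
  E? n = separated? (γ * ι n)
  far⇒g≤ : ∀ n h → ¬ (L ℕ.* h ℕ.≤ n) → γ * ι n ≤ ι h
  far⇒g≤ n h far = begin
    γ * ι n            ≤⟨ *-monoˡ-≤ γ (ℚ.<⇒≤ 0<γ) (ι-mono-≤ (ℕ.<⇒≤ (ℕ.≰⇒> far))) ⟩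
    γ * ι (L ℕ.* h)    ≡⟨ cong (λ z → γ * z) (ι-* L h) ⟩
    γ * (ι L * ι h)    ≡⟨ regroup γ (ι L) (ι h) ⟩
    ι L * γ * ι h      ≡⟨ cong (_* ι h) (proj₂ (proj₂ γ-choice)) ⟩
    1ℚ * ι h           ≡⟨ ℚ.*-identityˡ (ι h) ⟩
    ι h                ∎
    where
    regroup : ∀ a b c → a * (b * c) ≡ b * a * c
    regroup = solve-∀ ℚ-ring
  p≤½+¼ : ∃[ N ] (∀ j → N ℕ.≤ j → seq p j ≤ ½ + ¼)
  p≤½+¼ = p≤½ ¼ (ℚ.positive⁻¹ ¼)
  -- From coordinate `J` on both bounds on `p` hold; `J` is independent of `n`.
  J : ℕ
  J = N₁ ℕ.⊔ proj₁ p≤½+¼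
  module At (j : ℕ) (J≤j : J ℕ.≤ j) (n : ℕ) where
    Pⱼ : ℚ
    Pⱼ = seq (Pr (Q p n (⌈sn⌉ n)) (E? n)) j
    ε≤p : ε ≤ seq p j
    ε≤p = ℚ.≤-trans ε≤ε₁ (ℚ.≤-trans (ℚ.≤-reflexive (sym (ℚ.+-identityˡ ε₁)))
            (ε₁≤p j (ℕ.m⊔n≤o⇒m≤o N₁ (proj₁ p≤½+¼) J≤j)))
    p≤θ : seq p j ≤ θ
    p≤θ = ℚ.≤-trans (proj₂ p≤½+¼ j (ℕ.m⊔n≤o⇒n≤o N₁ (proj₁ p≤½+¼) J≤j)) (1-antitone ε≤¼)
    0≤p : 0ℚ ≤ seq p j
    0≤p = ℚ.≤-trans (ℚ.<⇒≤ 0<ε) ε≤p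
    p≤1 : seq p j ≤ 1ℚ
    p≤1 = ℚ.≤-trans p≤θ (1-antitone (ℚ.<⇒≤ 0<ε))
    Pⱼ≤1 : Pⱼ ≤ 1ℚ
    Pⱼ≤1 = Pr≤1 j p θ p≤θ (1-antitone ε≤p) 0≤p p≤1 n (⌈sn⌉ n) (E? n)
    ½*defect≤q^n : ½ * (1ℚ - Pⱼ) ≤ q ^ n
    ½*defect≤q^n = ½*defect≤ {K = K} 0<q q≤1 ½≤θ θ≤q^4K (^-nonNeg 0≤q L) q[1+q^L]≤1
      (proj₂ (ceiling-lower-bound {s} 0<s) n (⌈sn⌉ n) (isCeiling n)) Pⱼ≤1
      (Pr-bound j p θ p≤θ (1-antitone ε≤p) 0≤p p≤1 0≤q q≤1 L n (⌈sn⌉ n) (E? n)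
        λ φ far σ τ σ⊨φ τ⊨φ σ≢τ → ≤⇒≤ℝ (far⇒g≤ n (hamming σ τ) (far σ τ σ⊨φ τ⊨φ σ≢τ)))
  converges : (λ n → Pr (Q p n (⌈sn⌉ n)) (E? n)) ⟶ 1ℝ
  converges η (η₀ , 0<η₀ , M , η₀≤η) = N , λ n N≤n →
      -- A strict inequality of reals needs a rational gap at all late coordinates. Below, half of
      -- `η₀` is spent on the defect `1ℚ - Pⱼ`; above, all of `η₀` remains since `Pⱼ ≤ 1ℚ`.
      (½ * η₀ , 0<½η₀ , M ℕ.⊔ J , λ j M⊔J≤j → lower n N≤n j M⊔J≤j) ,
      (η₀ , 0<η₀ , M ℕ.⊔ J , λ j M⊔J≤j → upper n j M⊔J≤j)
    where
    0<½η₀ : 0ℚ < ½ * η₀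
    0<½η₀ = 0<* (ℚ.positive⁻¹ ½) 0<η₀
    -- The outer ½ matches the one in `½*defect≤`, leaving a defect of at most `½ * η₀`.
    N-choice : ∃[ N ] (∀ n → N ℕ.≤ n → q ^ n ≤ ½ * (½ * η₀))
    N-choice = ^-vanishes 0<δ δ≤1 (0<* (ℚ.positive⁻¹ ½) 0<½η₀)
    N : ℕ
    N = proj₁ N-choice
    η₀≤ηⱼ : ∀ j → M ℕ.⊔ J ℕ.≤ j → η₀ ≤ seq η j
    η₀≤ηⱼ j M⊔J≤j = ℚ.≤-trans (ℚ.≤-reflexive (sym (ℚ.+-identityˡ η₀))) (η₀≤η j (ℕ.m⊔n≤o⇒m≤o M J M⊔J≤j))
    lower : ∀ n → N ℕ.≤ n → ∀ j → M ℕ.⊔ J ℕ.≤ j →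
            1ℚ - seq η j + ½ * η₀ ≤ seq (Pr (Q p n (⌈sn⌉ n)) (E? n)) j
    lower n N≤n j M⊔J≤j = begin
      1ℚ - seq η j + ½ * η₀    ≤⟨ ℚ.+-monoˡ-≤ (½ * η₀) (1-antitone (η₀≤ηⱼ j M⊔J≤j)) ⟩
      1ℚ - η₀ + ½ * η₀         ≡⟨ cong (λ z → 1ℚ - z + ½ * η₀) (halves η₀) ⟨
      1ℚ - (½ * η₀ + ½ * η₀) + ½ * η₀  ≡⟨ cancel (½ * η₀) ⟩
      1ℚ - ½ * η₀              ≤⟨ 1-antitone defect≤½η₀ ⟩
      1ℚ - (1ℚ - Pⱼ)           ≡⟨ involutive Pⱼ ⟩
      Pⱼ                       ∎
      where
      open At j (ℕ.m⊔n≤o⇒n≤o M J M⊔J≤j) n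
      defect≤½η₀ : 1ℚ - Pⱼ ≤ ½ * η₀
      defect≤½η₀ = ℚ.*-cancelˡ-≤-pos ½ (ℚ.≤-trans ½*defect≤q^n (proj₂ N-choice n N≤n))
      halves : ∀ a → ½ * a + ½ * a ≡ a
      halves a = trans (sym (ℚ.*-distribʳ-+ a ½ ½)) (ℚ.*-identityˡ a)
      cancel : ∀ a → 1ℚ - (a + a) + a ≡ 1ℚ - a
      cancel = solve-∀ ℚ-ring
      involutive : ∀ a → 1ℚ - (1ℚ - a) ≡ a
      involutive = solve-∀ ℚ-ring
    upper : ∀ n j → M ℕ.⊔ J ℕ.≤ j →
            seq (Pr (Q p n (⌈sn⌉ n)) (E? n)) j + η₀ ≤ 1ℚ + seq η j
    upper n j M⊔J≤j = ℚ.+-mono-≤ (At.Pⱼ≤1 j (ℕ.m⊔n≤o⇒n≤o M J M⊔J≤j) n) (η₀≤ηⱼ j M⊔J≤j)
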